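{- Let $n>2$ and let $C=[c_{ij}]$ be an $n\times n$ reciprocal PC matrix with entries in the multiplicative alo-group $(\mathbb{R}_{+},\cdot,\leq)$ of positive real numbers. Let $w=[w(a_1),\ldots,w(a_n)]^T$ be the priority vector generated by the (generalized) geometric mean method, i.e. \[ w(a_i)=\delta\cdot\Big(\prod_{r=1}^{n}c_{ir}\Big)^{1/n},\quad i\in\{1,\ldots,n\},\qquad \delta=\prod_{s=1}^{n}\Big(\prod_{r=1}^{n}c_{sr}\Big)^{ -1/n}. \] Let $i,j,k,l\in\{1,\ldots,n\}$. If \[ c_{ij}>\frac{1}{1-KI(C)},\qquad c_{kl}>\frac{1}{1-KI(C)}, \] and \[ \frac{c_{ij}}{c_{kl}}>\left(\frac{1}{1-KI(C)}\right)^{2}, \] then \[ w(a_i)>w(a_j),\qquad w(a_k)>w(a_l), \] and \[ \frac{w(a_i)}{w(a_j)}>\frac{w(a_k)}{w(a_l)}. \]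
   Context: $\mathbb{R}_+$ denotes the set of positive real numbers. A PC (pairwise comparisons) matrix $C=[c_{ij}]$ with $c_{ij}\in\mathbb{R}_+$ is reciprocal if $c_{ij}c_{ji}=1$ for all $i,j\in\{1,\ldots,n\}$. The value $w(a_i)$ is the weight of the $i$-th alternative $a_i$. Koczkodaj's inconsistency index of an $n\times n$ reciprocal matrix $C=[c_{ij}]$ with $n>2$ is \[ KI(C)=\max_{i,j,k\in\{1,\ldots,n\}}\left\{1-\min\left\{\frac{c_{ij}}{c_{ik}c_{kj}},\frac{c_{ik}c_{kj}}{c_{ij}}\right\}\right\}. \] -}

module Defs where

open import Algebra.Bundles.Raw using (RawMonoid)
import Algebra.Definitions.RawMonoid
import Algebra.Definitions.RawSemiring
import Data.Integer as ℤ
import Data.Integer.Properties as ℤ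
open import Data.Fin using (Fin; zero; suc)
open import Data.Nat as ℕ using (ℕ; zero; suc)
import Data.Nat.Properties as ℕ
open import Data.Product using (∃-syntax; _×_; _,_; proj₁; proj₂)
open import Data.Rational
open import Data.Rational.Properties hiding (_≟_)
open import Data.Rational.Solver using (module +-*-Solver)
import Data.Rational.Unnormalised as ℚᵘ
open import Data.Sum using (inj₁; inj₂)
open import Data.Vec.Functional using (Vector)
open import Function using (_∘_)
open import Level using (0ℓ)
open import Relation.Binary.PropositionalEquality
open import Relation.Nullary using (yes; no; contradiction)

open Algebra.Definitions.RawSemiring +-*-rawSemiring using (_^_) public

module ℚ-facts where

  open ≤-Reasoning
  open +-*-Solver

  p≤∣p∣ : ∀ p → p ≤ ∣ p ∣
  p≤∣p∣ p with ≤-total 0ℚ p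
  ... | inj₁ 0≤p = ≤-reflexive (sym (0≤p⇒∣p∣≡p 0≤p))
  ... | inj₂ p≤0 = ≤-trans p≤0 (0≤∣p∣ p)

  p≤q+∣p-q∣ : ∀ p q → p ≤ q + ∣ p - q ∣
  p≤q+∣p-q∣ p q = begin
    p             ≡⟨ solve 2 (λ p q → p := q :+ (p :- q)) refl p q ⟩
    q + (p - q)   ≤⟨ +-monoʳ-≤ q (p≤∣p∣ (p - q)) ⟩
    q + ∣ p - q ∣ ∎

  ∣p-q∣≡∣q-p∣ : ∀ p q → ∣ p - q ∣ ≡ ∣ q - p ∣
  ∣p-q∣≡∣q-p∣ p q = trans
    (cong ∣_∣ (solve 2 (λ p q → p :- q := :- (q :- p)) refl p q))
    (∣-p∣≡∣p∣ (q - p))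

  p≤q+r⇒p-q≤r : ∀ {p q r} → p ≤ q + r → p - q ≤ r
  p≤q+r⇒p-q≤r {p} {q} {r} h = begin
    p - q       ≤⟨ +-monoˡ-≤ (- q) h ⟩
    q + r - q   ≡⟨ solve 2 (λ q r → q :+ r :- q := r) refl q r ⟩
    r           ∎

  ∣-∣≤ : ∀ {p q r} → p ≤ q + r → q ≤ p + r → ∣ p - q ∣ ≤ r
  ∣-∣≤ {p} {q} {r} p≤ q≤ with ∣p∣≡p∨∣p∣≡-p (p - q)
  ... | inj₁ eq = ≤-trans (≤-reflexive eq) (p≤q+r⇒p-q≤r p≤)
  ... | inj₂ eq = ≤-trans
    (≤-reflexive (trans eq (solve 2 (λ p q → :- (p :- q) := q :- p) refl p q)))
    (p≤q+r⇒p-q≤r q≤)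

  ∣-∣≤⇒≤ : ∀ {p q r} → ∣ p - q ∣ ≤ r → p ≤ q + r
  ∣-∣≤⇒≤ {p} {q} h = ≤-trans (p≤q+∣p-q∣ p q) (+-monoʳ-≤ q h)

  p≤p+q : ∀ {p q} → 0ℚ ≤ q → p ≤ p + q
  p≤p+q {p} 0≤q = ≤-trans (≤-reflexive (sym (+-identityʳ p))) (+-monoʳ-≤ p 0≤q)

  p≤q+p : ∀ {p q} → 0ℚ ≤ q → p ≤ q + p
  p≤q+p {p} 0≤q = ≤-trans (≤-reflexive (sym (+-identityˡ p))) (+-monoˡ-≤ p 0≤q)

  0⊔-mono : ∀ p q {r} → 0ℚ ≤ r → p ≤ q + r → 0ℚ ⊔ p ≤ (0ℚ ⊔ q) + r
  0⊔-mono p q {r} 0≤r h = ⊔-lub {(0ℚ ⊔ q) + r} {0ℚ} {p}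
    (≤-trans (p≤p⊔q 0ℚ q) (p≤p+q {0ℚ ⊔ q} {r} 0≤r))
    (≤-trans h (+-monoˡ-≤ r (p≤q⊔p 0ℚ q)))

  0<p⊓q : ∀ {p q} → 0ℚ < p → 0ℚ < q → 0ℚ < p ⊓ q
  0<p⊓q {p} {q} 0<p 0<q with ⊓-sel p q
  ... | inj₁ eq = subst (0ℚ <_) (sym eq) 0<p
  ... | inj₂ eq = subst (0ℚ <_) (sym eq) 0<q

  0<p+q : ∀ {p q} → 0ℚ < p → 0ℚ ≤ q → 0ℚ < p + q
  0<p+q 0<p 0≤q = <-≤-trans 0<p (p≤p+q 0≤q)

  1-p+q≤1 : ∀ {p q} → 0ℚ + q ≤ p → 1ℚ - p + q ≤ 1ℚ
  1-p+q≤1 {p} {q} h = begin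
    1ℚ - p + q         ≡⟨ solve 2 (λ p q → con 1ℚ :- p :+ q := con 1ℚ :- p :+ (con 0ℚ :+ q)) refl p q ⟩
    1ℚ - p + (0ℚ + q)  ≤⟨ +-monoʳ-≤ (1ℚ - p) h ⟩
    1ℚ - p + p         ≡⟨ solve 1 (λ p → con 1ℚ :- p :+ p := con 1ℚ) refl p ⟩
    1ℚ                 ∎

  0+q≤1-p : ∀ {p q} → p + q ≤ 1ℚ → 0ℚ + q ≤ 1ℚ - p
  0+q≤1-p {p} {q} h = begin
    0ℚ + q      ≡⟨ solve 2 (λ p q → con 0ℚ :+ q := p :+ q :- p) refl p q ⟩
    p + q - p   ≤⟨ +-monoˡ-≤ (- p) h ⟩
    1ℚ - p      ∎

  *-mono : ∀ {p q r s} → 0ℚ ≤ p → 0ℚ ≤ s → p ≤ q → r ≤ s → p * r ≤ q * s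
  *-mono {p} {q} {r} {s} 0≤p 0≤s p≤q r≤s = ≤-trans
    (*-monoˡ-≤-nonNeg p {{nonNegative 0≤p}} r≤s)
    (*-monoʳ-≤-nonNeg s {{nonNegative 0≤s}} p≤q)

  0≤p*q : ∀ {p q} → 0ℚ ≤ p → 0ℚ ≤ q → 0ℚ ≤ p * q
  0≤p*q {p} {q} 0≤p 0≤q = ≤-trans (≤-reflexive (sym (*-zeroˡ q)))
    (*-mono ≤-refl 0≤q 0≤p (≤-refl {q}))

  0<p*q : ∀ {p q} → 0ℚ < p → 0ℚ < q → 0ℚ < p * q
  0<p*q {p} {q} 0<p 0<q = positive⁻¹ (p * q)
    {{pos*pos⇒pos p {{positive 0<p}} q {{positive 0<q}}}}

  0<1 : 0ℚ < 1ℚ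
  0<1 = positive⁻¹ 1ℚ

  0≤1 : 0ℚ ≤ 1ℚ
  0≤1 = <⇒≤ 0<1

  0<½* : ∀ {p} → 0ℚ < p → 0ℚ < ½ * p
  0<½* = 0<p*q (positive⁻¹ ½)

  ½+½ : ∀ p → ½ * p + ½ * p ≡ p
  ½+½ p = trans (sym (*-distribʳ-+ p ½ ½)) (*-identityˡ p)

  recip : ∀ p → 0ℚ < p → ℚ
  recip p 0<p = (1/ p) {{pos⇒nonZero p {{positive 0<p}}}}

  *-recip : ∀ p 0<p → p * recip p 0<p ≡ 1ℚ
  *-recip p 0<p = *-inverseʳ p {{pos⇒nonZero p {{positive 0<p}}}}

  0<recip : ∀ p 0<p → 0ℚ < recip p 0<p
  0<recip p 0<p = positive⁻¹ (recip p 0<p) {{1/pos⇒pos p {{positive 0<p}}}}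

  recip-≤ : ∀ {p q ε} 0<p 0<q → 0ℚ ≤ ε → q ≤ p + ε * (p * q) →
            recip p 0<p ≤ recip q 0<q + ε
  recip-≤ {p} {q} {ε} 0<p 0<q 0≤ε h =
    *-cancelˡ-≤-pos (p * q) {{positive (0<p*q 0<p 0<q)}} (begin
      p * q * recip p 0<p         ≡⟨ solve 3 (λ p q r → p :* q :* r := (p :* r) :* q) refl p q (recip p 0<p) ⟩
      p * recip p 0<p * q         ≡⟨ cong (_* q) (*-recip p 0<p) ⟩
      1ℚ * q                      ≡⟨ *-identityˡ q ⟩
      q                           ≤⟨ h ⟩
      p + ε * (p * q)             ≡⟨ cong (_+ ε * (p * q)) (sym (*-identityʳ p)) ⟩
      p * 1ℚ + ε * (p * q)        ≡⟨ cong (λ t → p * t + ε * (p * q)) (sym (*-recip q 0<q)) ⟩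
      p * (q * recip q 0<q) + ε * (p * q)
        ≡⟨ solve 4 (λ p q r ε → p :* (q :* r) :+ ε :* (p :* q) := p :* q :* (r :+ ε)) refl p q (recip q 0<q) ε ⟩
      p * q * (recip q 0<q + ε)   ∎)

  recip-antimono : ∀ {p q} 0<p 0<q → p ≤ q → recip q 0<q ≤ recip p 0<p
  recip-antimono {p} {q} 0<p 0<q p≤q = *-cancelˡ-≤-pos q {{positive 0<q}} (begin
    q * recip q 0<q  ≡⟨ *-recip q 0<q ⟩
    1ℚ               ≡⟨ sym (*-recip p 0<p) ⟩
    p * recip p 0<p  ≤⟨ *-monoʳ-≤-nonNeg (recip p 0<p) {{nonNegative (<⇒≤ (0<recip p 0<p))}} p≤q ⟩
    q * recip p 0<p  ∎)

  0<p⊔q : ∀ {p} q → 0ℚ < p → 0ℚ < p ⊔ q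
  0<p⊔q {p} q 0<p = <-≤-trans 0<p (p≤p⊔q p q)

  recip-⊔ : ∀ {ε η} p q 0<ε → 0ℚ ≤ η → q ≤ p + η * (ε * ε) →
            recip (ε ⊔ p) (0<p⊔q p 0<ε) ≤ recip (ε ⊔ q) (0<p⊔q q 0<ε) + η
  recip-⊔ {ε} {η} p q 0<ε 0≤η h = recip-≤ (0<p⊔q p 0<ε) (0<p⊔q q 0<ε) 0≤η (begin
    ε ⊔ q                ≤⟨ ⊔-lub (≤-trans (p≤p⊔q ε p) (p≤p+q {ε ⊔ p} {η * (ε * ε)} 0≤δ))
                                  (≤-trans h (+-monoˡ-≤ (η * (ε * ε)) (p≤q⊔p ε p))) ⟩
    (ε ⊔ p) + η * (ε * ε)
      ≤⟨ +-monoʳ-≤ (ε ⊔ p) (*-monoˡ-≤-nonNeg η {{nonNegative 0≤η}}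
           (*-mono {ε} {ε ⊔ p} {ε} {ε ⊔ q} (<⇒≤ 0<ε) (<⇒≤ (0<p⊔q q 0<ε)) (p≤p⊔q ε p) (p≤p⊔q ε q))) ⟩
    (ε ⊔ p) + η * ((ε ⊔ p) * (ε ⊔ q)) ∎)
    where
    0≤δ : 0ℚ ≤ η * (ε * ε)
    0≤δ = 0≤p*q {η} {ε * ε} 0≤η (0≤p*q {ε} {ε} (<⇒≤ 0<ε) (<⇒≤ 0<ε))

  p*[q*recip] : ∀ p q 0<p → p * (q * recip p 0<p) ≡ q
  p*[q*recip] p q 0<p = begin-equality
    p * (q * recip p 0<p)  ≡⟨ solve 3 (λ p q r → p :* (q :* r) := q :* (p :* r)) refl p q (recip p 0<p) ⟩
    q * (p * recip p 0<p)  ≡⟨ cong (q *_) (*-recip p 0<p) ⟩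
    q * 1ℚ                 ≡⟨ *-identityʳ q ⟩
    q                      ∎

  ∣p*q-p′*q′∣≤ : ∀ p p′ q q′ {A B δ} → ∣ p ∣ ≤ A → ∣ q′ ∣ ≤ B →
                 ∣ p - p′ ∣ ≤ δ → ∣ q - q′ ∣ ≤ δ → 0ℚ ≤ δ →
                 ∣ p * q - p′ * q′ ∣ ≤ (A + B) * δ
  ∣p*q-p′*q′∣≤ p p′ q q′ {A} {B} {δ} p≤A q′≤B hp hq 0≤δ = begin
    ∣ p * q - p′ * q′ ∣
      ≡⟨ cong ∣_∣ (solve 4 (λ p p′ q q′ → p :* q :- p′ :* q′ := p :* (q :- q′) :+ q′ :* (p :- p′)) refl p p′ q q′) ⟩
    ∣ p * (q - q′) + q′ * (p - p′) ∣
      ≤⟨ ∣p+q∣≤∣p∣+∣q∣ (p * (q - q′)) (q′ * (p - p′)) ⟩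
    ∣ p * (q - q′) ∣ + ∣ q′ * (p - p′) ∣
      ≡⟨ cong₂ _+_ (∣p*q∣≡∣p∣*∣q∣ p (q - q′)) (∣p*q∣≡∣p∣*∣q∣ q′ (p - p′)) ⟩
    ∣ p ∣ * ∣ q - q′ ∣ + ∣ q′ ∣ * ∣ p - p′ ∣
      ≤⟨ +-mono-≤ (*-mono (0≤∣p∣ p) 0≤δ p≤A hq) (*-mono (0≤∣p∣ q′) 0≤δ q′≤B hp) ⟩
    A * δ + B * δ
      ≡⟨ sym (*-distribʳ-+ δ A B) ⟩
    (A + B) * δ ∎

  0≤^ : ∀ {p} n → 0ℚ ≤ p → 0ℚ ≤ p ^ n
  0≤^ zero    0≤p = 0≤1
  0≤^ (suc n) 0≤p = 0≤p*q 0≤p (0≤^ n 0≤p)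

  0<^ : ∀ {p} n → 0ℚ < p → 0ℚ < p ^ n
  0<^ zero    0<p = 0<1
  0<^ (suc n) 0<p = 0<p*q 0<p (0<^ n 0<p)

  ^-mono-≤ : ∀ {p q} n → 0ℚ ≤ p → p ≤ q → p ^ n ≤ q ^ n
  ^-mono-≤ zero    0≤p p≤q = ≤-refl
  ^-mono-≤ (suc n) 0≤p p≤q =
    *-mono 0≤p (0≤^ n (≤-trans 0≤p p≤q)) p≤q (^-mono-≤ n 0≤p p≤q)

  ^-mono-< : ∀ {p q} n .{{_ : ℕ.NonZero n}} → 0ℚ ≤ p → p < q → p ^ n < q ^ n
  ^-mono-< {p} {q} (suc n) 0≤p p<q = ≤-<-trans
    (*-monoˡ-≤-nonNeg p {{nonNegative 0≤p}} (^-mono-≤ n 0≤p (<⇒≤ p<q)))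
    (*-monoˡ-<-pos (q ^ n) {{positive (0<^ n (≤-<-trans 0≤p p<q))}} p<q)

  ^-cancel-≤ : ∀ {p q} n .{{_ : ℕ.NonZero n}} → 0ℚ ≤ q → p ^ n ≤ q ^ n → p ≤ q
  ^-cancel-≤ {p} {q} n 0≤q h with p ≤? q
  ... | yes p≤q = p≤q
  ... | no  p≰q = contradiction h (<⇒≱ (^-mono-< n 0≤q (≰⇒> p≰q)))
    where
    <⇒≱ : ∀ {p q} → p < q → q ≰ p
    <⇒≱ p<q q≤p = <-irrefl refl (<-≤-trans p<q q≤p)

  ^-superadditive : ∀ {p q} n .{{_ : ℕ.NonZero n}} → 0ℚ ≤ p → 0ℚ ≤ q →
                    p ^ n + q ^ n ≤ (p + q) ^ n
  ^-superadditive {p} {q} (suc n) 0≤p 0≤q = begin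
    p * p ^ n + q * q ^ n
      ≤⟨ +-mono-≤ (*-monoˡ-≤-nonNeg p {{nonNegative 0≤p}} (^-mono-≤ n 0≤p (p≤p+q 0≤q)))
                  (*-monoˡ-≤-nonNeg q {{nonNegative 0≤q}} (^-mono-≤ n 0≤q (p≤q+p 0≤p))) ⟩
    p * (p + q) ^ n + q * (p + q) ^ n  ≡⟨ sym (*-distribʳ-+ ((p + q) ^ n) p q) ⟩
    (p + q) * (p + q) ^ n              ∎

  p^n≤1 : ∀ {p} n → 0ℚ ≤ p → p ≤ 1ℚ → p ^ n ≤ 1ℚ
  p^n≤1 zero    0≤p p≤1 = ≤-refl
  p^n≤1 (suc n) 0≤p p≤1 = ≤-trans (*-mono 0≤p 0≤1 p≤1 (p^n≤1 n 0≤p p≤1))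
                                  (≤-reflexive (*-identityˡ 1ℚ))

  p^n≤p : ∀ {p} n .{{_ : ℕ.NonZero n}} → 0ℚ ≤ p → p ≤ 1ℚ → p ^ n ≤ p
  p^n≤p {p} (suc n) 0≤p p≤1 = ≤-trans
    (*-monoˡ-≤-nonNeg p {{nonNegative 0≤p}} (p^n≤1 n 0≤p p≤1))
    (≤-reflexive (*-identityʳ p))

  1≤p^n : ∀ {p} n → 1ℚ ≤ p → 1ℚ ≤ p ^ n
  1≤p^n zero    1≤p = ≤-refl
  1≤p^n (suc n) 1≤p = ≤-trans (≤-reflexive (sym (*-identityˡ 1ℚ)))
    (*-mono 0≤1 (≤-trans 0≤1 (1≤p^n n 1≤p)) 1≤p (1≤p^n n 1≤p))

  p≤p^n : ∀ {p} n .{{_ : ℕ.NonZero n}} → 1ℚ ≤ p → p ≤ p ^ n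
  p≤p^n {p} (suc n) 1≤p = ≤-trans (≤-reflexive (sym (*-identityʳ p)))
    (*-monoˡ-≤-nonNeg p {{nonNegative (≤-trans 0≤1 1≤p)}} (1≤p^n n 1≤p))

  fromℕ : ℕ → ℚ
  fromℕ zero    = 0ℚ
  fromℕ (suc n) = 1ℚ + fromℕ n

  0≤fromℕ : ∀ n → 0ℚ ≤ fromℕ n
  0≤fromℕ zero    = ≤-refl
  0≤fromℕ (suc n) = ≤-trans (0≤fromℕ n) (p≤q+p 0≤1)

  fromℕ-/ : ∀ n → toℚᵘ (fromℕ n) ℚᵘ.≃ ℚᵘ.mkℚᵘ (ℤ.+ n) 0
  fromℕ-/ zero    = ℚᵘ.*≡* refl
  fromℕ-/ (suc n) = ℚᵘ.≃-trans (toℚᵘ-homo-+ 1ℚ (fromℕ n))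
    (ℚᵘ.≃-trans (ℚᵘ.+-congʳ (toℚᵘ 1ℚ) (fromℕ-/ n)) (ℚᵘ.*≡* (cong (ℤ._* ℤ.+ 1) eq)))
    where
    import Data.Rational.Unnormalised.Properties as ℚᵘ
    eq : ℤ.+ 1 ℤ.* ℤ.+ 1 ℤ.+ ℤ.+ n ℤ.* ℤ.+ 1 ≡ ℤ.+ suc n
    eq = cong (λ z → ℤ.+ 1 ℤ.+ z) (ℤ.*-identityʳ (ℤ.+ n))

  archimedean : ∀ p → ∃[ n ] p ≤ fromℕ n
  archimedean p@(mkℚ a d _) = ℤ.∣ a ∣ , toℚᵘ-cancel-≤
    (ℚᵘ.≤-respʳ-≃ (ℚᵘ.≃-sym (fromℕ-/ ℤ.∣ a ∣)) (ℚᵘ.*≤* (bound a)))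
    where
    import Data.Rational.Unnormalised.Properties as ℚᵘ
    bound : ∀ a → a ℤ.* ℤ.+ 1 ℤ.≤ ℤ.+ ℤ.∣ a ∣ ℤ.* ℤ.+ suc d
    bound (ℤ.+ m)    = ℤ.≤-trans (ℤ.≤-reflexive (ℤ.*-identityʳ (ℤ.+ m)))
      (ℤ.≤-trans (ℤ.+≤+ (ℕ.m≤m*n m (suc d))) (ℤ.≤-reflexive (ℤ.pos-* m (suc d))))
    bound ℤ.-[1+ m ] = ℤ.-≤+

  fromℕ*½^ : ∀ n → fromℕ (suc n) * ½ ^ n ≤ 1ℚ
  fromℕ*½^ zero    = ≤-refl
  fromℕ*½^ (suc n) = begin
    (1ℚ + (1ℚ + x)) * (½ * h)   ≤⟨ *-monoʳ-≤-nonNeg (½ * h) {{nonNegative (0≤p*q (<⇒≤ (positive⁻¹ ½)) 0≤h)}}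
                                     (+-monoʳ-≤ 1ℚ (+-monoʳ-≤ 1ℚ (p≤p+q {x} (0≤fromℕ n)))) ⟩
    (1ℚ + (1ℚ + (x + x))) * (½ * h)
      ≡⟨ solve 2 (λ x h → (con 1ℚ :+ (con 1ℚ :+ (x :+ x))) :* (con ½ :* h) := (con 1ℚ :+ x) :* h) refl x h ⟩
    (1ℚ + x) * h                ≤⟨ fromℕ*½^ n ⟩
    1ℚ                          ∎
    where
    x = fromℕ n
    h = ½ ^ n
    0≤h : 0ℚ ≤ h
    0≤h = 0≤^ n (<⇒≤ (positive⁻¹ ½))

  ½^-antimono : ∀ {m n} → m ℕ.≤ n → ½ ^ n ≤ ½ ^ m
  ½^-antimono {n = n} ℕ.z≤n     = p^n≤1 n (<⇒≤ (positive⁻¹ ½)) (≤ᵇ⇒≤ _)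
  ½^-antimono (ℕ.s≤s m≤n)       = *-monoˡ-≤-nonNeg ½ (½^-antimono m≤n)

  -- For every B and ε > 0, B / 2ᵏ ≤ ε from some k on.
  ½^-limit : ∀ B {ε} → 0ℚ < ε → ∃[ N ] ∀ {k} → N ℕ.≤ k → B * ½ ^ k ≤ ε
  ½^-limit B {ε} 0<ε = N , λ {k} N≤k → begin
    B * ½ ^ k                    ≤⟨ *-monoʳ-≤-nonNeg (½ ^ k) {{nonNegative (0≤½^ k)}} B≤ ⟩
    ε * fromℕ (suc N) * ½ ^ k    ≡⟨ *-assoc ε (fromℕ (suc N)) (½ ^ k) ⟩
    ε * (fromℕ (suc N) * ½ ^ k)  ≤⟨ *-monoˡ-≤-nonNeg ε (*-monoˡ-≤-nonNeg (fromℕ (suc N))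
                                      {{nonNegative (0≤fromℕ (suc N))}} (½^-antimono N≤k)) ⟩
    ε * (fromℕ (suc N) * ½ ^ N)  ≤⟨ *-monoˡ-≤-nonNeg ε (fromℕ*½^ N) ⟩
    ε * 1ℚ                       ≡⟨ *-identityʳ ε ⟩
    ε                            ∎
    where
    0≤½^ : ∀ k → 0ℚ ≤ ½ ^ k
    0≤½^ k = 0≤^ k (<⇒≤ (positive⁻¹ ½))
    N = proj₁ (archimedean (B * recip ε 0<ε))
    instance
      ε-nonNeg : NonNegative ε
      ε-nonNeg = nonNegative (<⇒≤ 0<ε)
    B≤ : B ≤ ε * fromℕ (suc N)
    B≤ = begin
      B                        ≡⟨ sym (p*[q*recip] ε B 0<ε) ⟩
      ε * (B * recip ε 0<ε)    ≤⟨ *-monoˡ-≤-nonNeg ε (≤-trans (proj₂ (archimedean (B * recip ε 0<ε))) (p≤q+p 0≤1)) ⟩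
      ε * fromℕ (suc N)        ∎

open ℚ-facts

record ℝ : Set where
  field
    seq    : ℕ → ℚ
    cauchy : ∀ {ε} → 0ℚ < ε →
             ∃[ N ] ∀ {m n} → N ℕ.≤ m → N ℕ.≤ n → ∣ seq m - seq n ∣ ≤ ε

open ℝ public

infix 4 _≈_ _<ʳ_

_≈_ : ℝ → ℝ → Set
x ≈ y = ∀ {ε} → 0ℚ < ε → ∃[ N ] ∀ {n} → N ℕ.≤ n → ∣ seq x n - seq y n ∣ ≤ ε

_<ʳ_ : ℝ → ℝ → Set
x <ʳ y = ∃[ ε ] 0ℚ < ε × ∃[ N ] ∀ {n} → N ℕ.≤ n → seq x n + ε ≤ seq y n

0ʳ 1ʳ : ℝ
0ʳ = record { seq = λ _ → 0ℚ ; cauchy = λ 0<ε → 0 , λ _ _ → <⇒≤ 0<ε }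
1ʳ = record { seq = λ _ → 1ℚ ; cauchy = λ 0<ε → 0 , λ _ _ → <⇒≤ 0<ε }

bounded : ∀ x → ∃[ B ] 0ℚ < B × ∃[ N ] ∀ {n} → N ℕ.≤ n → ∣ seq x n ∣ ≤ B
bounded x with cauchy x 0<1
... | N , h = ∣ seq x N ∣ + 1ℚ , <-≤-trans 0<1 (p≤q+p (0≤∣p∣ (seq x N))) , N , λ {n} N≤n →
  begin
    ∣ seq x n ∣                            ≡⟨ cong ∣_∣ (solve 2 (λ p q → p := q :+ (p :- q)) refl (seq x n) (seq x N)) ⟩
    ∣ seq x N + (seq x n - seq x N) ∣      ≤⟨ ∣p+q∣≤∣p∣+∣q∣ (seq x N) (seq x n - seq x N) ⟩
    ∣ seq x N ∣ + ∣ seq x n - seq x N ∣    ≤⟨ +-monoʳ-≤ ∣ seq x N ∣ (h N≤n ℕ.≤-refl) ⟩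
    ∣ seq x N ∣ + 1ℚ                       ∎
  where
  open ≤-Reasoning
  open +-*-Solver

NonExpansive₂ : (ℚ → ℚ → ℚ) → Set
NonExpansive₂ f = ∀ p p′ q q′ → f p q ≤ f p′ q′ + (∣ p - p′ ∣ + ∣ q - q′ ∣)

lift₂ : (f : ℚ → ℚ → ℚ) → NonExpansive₂ f → ℝ → ℝ → ℝ
lift₂ f nonExp x y = record
  { seq    = λ n → f (seq x n) (seq y n)
  ; cauchy = λ {ε} 0<ε →
      let M , hx = cauchy x (0<½* 0<ε)
          N , hy = cauchy y (0<½* 0<ε)
          dist : ∀ {m n} → M ℕ.⊔ N ℕ.≤ m → M ℕ.⊔ N ℕ.≤ n →
                 f (seq x m) (seq y m) ≤ f (seq x n) (seq y n) + ε
          dist {m} {n} ≤m ≤n = ≤-trans (nonExp _ _ _ _)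
            (+-monoʳ-≤ (f (seq x n) (seq y n)) (≤-trans
              (+-mono-≤ (hx (ℕ.m⊔n≤o⇒m≤o M N ≤m) (ℕ.m⊔n≤o⇒m≤o M N ≤n))
                        (hy (ℕ.m⊔n≤o⇒n≤o M N ≤m) (ℕ.m⊔n≤o⇒n≤o M N ≤n)))
              (≤-reflexive (½+½ ε))))
      in M ℕ.⊔ N , λ ≤m ≤n → ∣-∣≤ (dist ≤m ≤n) (dist ≤n ≤m)
  }

module nonExpansive where

  open ≤-Reasoning
  open +-*-Solver

  left : ∀ {p p′ r} s q q′ → p′ ≤ s → p ≤ p′ + r → p ≤ s + (r + ∣ q - q′ ∣)
  left {p} {p′} {r} s q q′ p′≤s h = begin
    p                      ≤⟨ h ⟩
    p′ + r                 ≤⟨ +-mono-≤ p′≤s (p≤p+q (0≤∣p∣ (q - q′))) ⟩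
    s + (r + ∣ q - q′ ∣)   ∎

  right : ∀ {p p′ r} s q q′ → p′ ≤ s → p ≤ p′ + r → p ≤ s + (∣ q - q′ ∣ + r)
  right {p} {p′} {r} s q q′ p′≤s h = begin
    p                      ≤⟨ h ⟩
    p′ + r                 ≤⟨ +-mono-≤ p′≤s (p≤q+p (0≤∣p∣ (q - q′))) ⟩
    s + (∣ q - q′ ∣ + r)   ∎

  ⊔-nonExpansive : NonExpansive₂ _⊔_
  ⊔-nonExpansive p p′ q q′ = ⊔-lub
    (left  (p′ ⊔ q′) q q′ (p≤p⊔q p′ q′) (p≤q+∣p-q∣ p p′))
    (right (p′ ⊔ q′) p p′ (p≤q⊔p p′ q′) (p≤q+∣p-q∣ q q′))

  ⊓-nonExpansive : NonExpansive₂ _⊓_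
  ⊓-nonExpansive p p′ q q′ with ⊓-sel p′ q′
  ... | inj₁ eq = left  (p′ ⊓ q′) q q′ (≤-reflexive (sym eq)) (≤-trans (p⊓q≤p p q) (p≤q+∣p-q∣ p p′))
  ... | inj₂ eq = right (p′ ⊓ q′) p p′ (≤-reflexive (sym eq)) (≤-trans (p⊓q≤q p q) (p≤q+∣p-q∣ q q′))

  -‿nonExpansive : NonExpansive₂ _-_
  -‿nonExpansive p p′ q q′ = begin
    p - q                                   ≡⟨ solve 3 (λ p q q′ → p :- q := p :+ q′ :- (q :+ q′)) refl p q q′ ⟩
    p + q′ - (q + q′)                       ≤⟨ +-monoˡ-≤ (- (q + q′)) (+-mono-≤ (p≤q+∣p-q∣ p p′) (p≤q+∣p-q∣ q′ q)) ⟩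
    p′ + d + (q + ∣ q′ - q ∣) - (q + q′)    ≡⟨ cong (λ e → p′ + d + (q + e) - (q + q′)) (∣p-q∣≡∣q-p∣ q′ q) ⟩
    p′ + d + (q + e) - (q + q′)             ≡⟨ solve 5 (λ p′ d q e q′ → p′ :+ d :+ (q :+ e) :- (q :+ q′) := p′ :- q′ :+ (d :+ e)) refl p′ d q e q′ ⟩
    p′ - q′ + (d + e)                       ∎
    where
    d = ∣ p - p′ ∣
    e = ∣ q - q′ ∣

open nonExpansive using (⊔-nonExpansive; ⊓-nonExpansive; -‿nonExpansive)

infixl 6 _-ʳ_ _⊔ʳ_
infixl 7 _*ʳ_ _⊓ʳ_

_-ʳ_ _⊔ʳ_ _⊓ʳ_ _*ʳ_ : ℝ → ℝ → ℝ
_-ʳ_ = lift₂ _-_ -‿nonExpansive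
_⊔ʳ_ = lift₂ _⊔_ ⊔-nonExpansive
_⊓ʳ_ = lift₂ _⊓_ ⊓-nonExpansive

x *ʳ y = record { seq = λ n → seq x n * seq y n ; cauchy = cauchy-* }
  where
  cauchy-* : ∀ {ε} → 0ℚ < ε → ∃[ N ] ∀ {m n} → N ℕ.≤ m → N ℕ.≤ n →
             ∣ seq x m * seq y m - seq x n * seq y n ∣ ≤ ε
  cauchy-* {ε} 0<ε = K ℕ.⊔ L ℕ.⊔ (M ℕ.⊔ N) , close
    where
    A = proj₁ (bounded x)
    B = proj₁ (bounded y)
    0<C : 0ℚ < A + B
    0<C = 0<p+q (proj₁ (proj₂ (bounded x))) (<⇒≤ (proj₁ (proj₂ (bounded y))))
    0<δ : 0ℚ < ε * recip (A + B) 0<C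
    0<δ = 0<p*q 0<ε (0<recip (A + B) 0<C)
    K = proj₁ (proj₂ (proj₂ (bounded x)))
    L = proj₁ (proj₂ (proj₂ (bounded y)))
    M = proj₁ (cauchy x 0<δ)
    N = proj₁ (cauchy y 0<δ)
    close : ∀ {m n} → K ℕ.⊔ L ℕ.⊔ (M ℕ.⊔ N) ℕ.≤ m → K ℕ.⊔ L ℕ.⊔ (M ℕ.⊔ N) ℕ.≤ n →
            ∣ seq x m * seq y m - seq x n * seq y n ∣ ≤ ε
    close {m} {n} ≤m ≤n = ≤-trans
      (∣p*q-p′*q′∣≤ (seq x m) (seq x n) (seq y m) (seq y n)
        (proj₂ (proj₂ (proj₂ (bounded x))) (ℕ.m⊔n≤o⇒m≤o K L (ℕ.m⊔n≤o⇒m≤o (K ℕ.⊔ L) (M ℕ.⊔ N) ≤m)))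
        (proj₂ (proj₂ (proj₂ (bounded y))) (ℕ.m⊔n≤o⇒n≤o K L (ℕ.m⊔n≤o⇒m≤o (K ℕ.⊔ L) (M ℕ.⊔ N) ≤n)))
        (proj₂ (cauchy x 0<δ) (ℕ.m⊔n≤o⇒m≤o M N MN≤m) (ℕ.m⊔n≤o⇒m≤o M N MN≤n))
        (proj₂ (cauchy y 0<δ) (ℕ.m⊔n≤o⇒n≤o M N MN≤m) (ℕ.m⊔n≤o⇒n≤o M N MN≤n))
        (<⇒≤ 0<δ))
      (≤-reflexive (p*[q*recip] (A + B) ε 0<C))
      where
      MN≤m = ℕ.m⊔n≤o⇒n≤o (K ℕ.⊔ L) (M ℕ.⊔ N) ≤m
      MN≤n = ℕ.m⊔n≤o⇒n≤o (K ℕ.⊔ L) (M ℕ.⊔ N) ≤n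

max : ∀ {n} .{{_ : ℕ.NonZero n}} → Vector ℝ n → ℝ
max {suc zero}    x = x zero
max {suc (suc n)} x = x zero ⊔ʳ max (x ∘ suc)

⊔ʳ-<ʳ : ∀ {x y z} → x <ʳ z → y <ʳ z → x ⊔ʳ y <ʳ z
⊔ʳ-<ʳ {x} {y} {z} (ε , 0<ε , M , hx) (η , 0<η , N , hy) =
  ε ⊓ η , 0<p⊓q 0<ε 0<η , M ℕ.⊔ N , λ {n} ≤n → begin
    (seq x n ⊔ seq y n) + (ε ⊓ η)
      ≡⟨ mono-≤-distrib-⊔ (+-monoˡ-≤ (ε ⊓ η)) (seq x n) (seq y n) ⟩
    (seq x n + (ε ⊓ η)) ⊔ (seq y n + (ε ⊓ η))
      ≤⟨ ⊔-lub
           (≤-trans (+-monoʳ-≤ (seq x n) (p⊓q≤p ε η)) (hx (ℕ.m⊔n≤o⇒m≤o M N ≤n)))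
           (≤-trans (+-monoʳ-≤ (seq y n) (p⊓q≤q ε η)) (hy (ℕ.m⊔n≤o⇒n≤o M N ≤n))) ⟩
    seq z n ∎
  where
  open ≤-Reasoning

max-<ʳ : ∀ {n} .{{_ : ℕ.NonZero n}} (x : Vector ℝ n) {z} → (∀ i → x i <ʳ z) → max x <ʳ z
max-<ʳ {suc zero}    x     x<z = x<z zero
max-<ʳ {suc (suc n)} x {z} x<z =
  ⊔ʳ-<ʳ {x zero} {max (x ∘ suc)} {z} (x<z zero) (max-<ʳ (x ∘ suc) {z} (x<z ∘ suc))

record ℝ₊ : Set where
  constructor _,_
  field
    value   : ℝ
    0<value : 0ʳ <ʳ value

open ℝ₊ public using (value)

infix  4 _≈₊_ _<₊_ _>₊_
infixl 7 _·_ _÷₊_ _⊓₊_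
infix  8 _⁻¹

_≈₊_ _<₊_ _>₊_ : ℝ₊ → ℝ₊ → Set
x ≈₊ y = value x ≈ value y
x <₊ y = value x <ʳ value y
x >₊ y = y <₊ x

1₊ : ℝ₊
1₊ = 1ʳ , (1ℚ , 0<1 , 0 , λ _ → ≤-refl)

_·_ : ℝ₊ → ℝ₊ → ℝ₊
(x , ε , 0<ε , M , hx) · (y , η , 0<η , N , hy) =
  (x *ʳ y) , (ε * η , 0<p*q 0<ε 0<η , M ℕ.⊔ N , λ {n} ≤n → begin
    0ℚ + ε * η            ≡⟨ +-identityˡ (ε * η) ⟩
    ε * η                 ≡⟨ cong₂ _*_ (sym (+-identityˡ ε)) (sym (+-identityˡ η)) ⟩
    (0ℚ + ε) * (0ℚ + η)   ≤⟨ *-mono (≤-trans (<⇒≤ 0<ε) (≤-reflexive (sym (+-identityˡ ε))))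
                               (≤-trans (<⇒≤ 0<η) (≤-trans (≤-reflexive (sym (+-identityˡ η)))
                                 (hy (ℕ.m⊔n≤o⇒n≤o M N ≤n))))
                               (hx (ℕ.m⊔n≤o⇒m≤o M N ≤n)) (hy (ℕ.m⊔n≤o⇒n≤o M N ≤n)) ⟩
    seq x n * seq y n     ∎)
  where open ≤-Reasoning

1-x<1 : ∀ x → 1ʳ -ʳ value x <ʳ 1ʳ
1-x<1 (x , ε , 0<ε , M , hx) = ε , 0<ε , M , λ {n} M≤n → 1-p+q≤1 {seq x n} {ε} (hx M≤n)

x<1⇒0<1-x : ∀ x → x <ʳ 1ʳ → 0ʳ <ʳ 1ʳ -ʳ x
x<1⇒0<1-x x (ε , 0<ε , M , hx) = ε , 0<ε , M , λ {n} M≤n → 0+q≤1-p {seq x n} {ε} (hx M≤n)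

_⊓₊_ : ℝ₊ → ℝ₊ → ℝ₊
(x , ε , 0<ε , M , hx) ⊓₊ (y , η , 0<η , N , hy) =
  (x ⊓ʳ y) , (ε ⊓ η , 0<p⊓q 0<ε 0<η , M ℕ.⊔ N , λ {n} ≤n → ⊓-glb
    (≤-trans (+-monoʳ-≤ 0ℚ (p⊓q≤p ε η)) (hx (ℕ.m⊔n≤o⇒m≤o M N ≤n)))
    (≤-trans (+-monoʳ-≤ 0ℚ (p⊓q≤q ε η)) (hy (ℕ.m⊔n≤o⇒n≤o M N ≤n))))

-- The first few terms of the sequence of a positive real may vanish, so they
-- are replaced by the lower bound ε that holds for all later terms.
_⁻¹ : ℝ₊ → ℝ₊
(x , ε , 0<ε , M , hx) ⁻¹ = x⁻¹ , inv-pos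
  where
  inv : ℕ → ℚ
  inv n = recip (ε ⊔ seq x n) (0<p⊔q (seq x n) 0<ε)

  cauchy-inv : ∀ {η} → 0ℚ < η → ∃[ N ] ∀ {m n} → N ℕ.≤ m → N ℕ.≤ n → ∣ inv m - inv n ∣ ≤ η
  cauchy-inv {η} 0<η = proj₁ (cauchy x 0<δ) , λ ≤m ≤n → ∣-∣≤ (dist ≤m ≤n) (dist ≤n ≤m)
    where
    0<δ = 0<p*q 0<η (0<p*q 0<ε 0<ε)
    dist : ∀ {m n} → proj₁ (cauchy x 0<δ) ℕ.≤ m → proj₁ (cauchy x 0<δ) ℕ.≤ n → inv m ≤ inv n + η
    dist {m} {n} ≤m ≤n = recip-⊔ (seq x m) (seq x n) 0<ε (<⇒≤ 0<η)
      (∣-∣≤⇒≤ {seq x n} {seq x m} (proj₂ (cauchy x 0<δ) ≤n ≤m))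

  x⁻¹ : ℝ
  x⁻¹ = record { seq = inv ; cauchy = cauchy-inv }

  inv-pos : 0ʳ <ʳ x⁻¹
  inv-pos =
    let B , 0<B , N , hB = bounded x
        0<C = 0<p+q {ε} {B} 0<ε (<⇒≤ 0<B)
    in recip (ε + B) 0<C , 0<recip (ε + B) 0<C , N , λ {n} N≤n →
      ≤-trans (≤-reflexive (+-identityˡ (recip (ε + B) 0<C)))
        (recip-antimono (0<p⊔q (seq x n) 0<ε) 0<C
          (⊔-lub (p≤p+q {ε} {B} (<⇒≤ 0<B)) (≤-trans (p≤∣p∣ (seq x n))
            (≤-trans (hB N≤n) (p≤q+p {B} {ε} (<⇒≤ 0<ε))))))

_÷₊_ : ℝ₊ → ℝ₊ → ℝ₊
x ÷₊ y = x · y ⁻¹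

-- Assuming c ≥ 0, the k-th pair (lo , hi) satisfies loⁿ ≤ c ≤ hiⁿ and
-- hi - lo = (c + 1) / 2ᵏ.
bisect : ℕ → ℚ → ℕ → ℚ × ℚ
bisect n c zero = 0ℚ , c + 1ℚ
bisect n c (suc k) with bisect n c k
... | lo , hi with (½ * (lo + hi)) ^ n ≤? c
...   | yes _ = ½ * (lo + hi) , hi
...   | no  _ = lo , ½ * (lo + hi)

module _ (n : ℕ) .{{_ : ℕ.NonZero n}} where

  open ≤-Reasoning
  open +-*-Solver

  record Bracket (c w : ℚ) (p : ℚ × ℚ) : Set where
    constructor bracket
    field
      0≤lo  : 0ℚ ≤ proj₁ p
      lo^≤  : proj₁ p ^ n ≤ c
      ≤hi^  : c ≤ proj₂ p ^ n
      width : proj₂ p ≡ proj₁ p + w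

  bisect-bracket : ∀ {c} → 0ℚ ≤ c → ∀ k → Bracket c ((c + 1ℚ) * ½ ^ k) (bisect n c k)
  bisect-bracket {c} 0≤c zero = bracket ≤-refl
    (≤-trans (p^n≤p n ≤-refl 0≤1) 0≤c)
    (≤-trans (p≤p+q 0≤1) (p≤p^n n (p≤q+p 0≤c)))
    (solve 1 (λ c → c :+ con 1ℚ := con 0ℚ :+ (c :+ con 1ℚ) :* con 1ℚ) refl c)
  bisect-bracket {c} 0≤c (suc k) with bisect n c k | bisect-bracket 0≤c k
  ... | lo , hi | bracket 0≤lo lo^≤ ≤hi^ refl with (½ * (lo + hi)) ^ n ≤? c
  ...   | yes mid^≤ = bracket
    (0≤p*q (<⇒≤ (positive⁻¹ ½)) (≤-trans 0≤lo (p≤p+q (≤-trans 0≤lo (p≤p+q 0≤w)))))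
    mid^≤ ≤hi^
    (solve 3 (λ l d h → l :+ d :* h := con ½ :* (l :+ (l :+ d :* h)) :+ d :* (con ½ :* h)) refl lo (c + 1ℚ) (½ ^ k))
    where
    0≤w : 0ℚ ≤ (c + 1ℚ) * ½ ^ k
    0≤w = 0≤p*q (≤-trans 0≤c (p≤p+q 0≤1)) (0≤^ k (<⇒≤ (positive⁻¹ ½)))
  ...   | no  mid^≰ = bracket 0≤lo lo^≤ (<⇒≤ (≰⇒> mid^≰))
    (solve 3 (λ l d h → con ½ :* (l :+ (l :+ d :* h)) := l :+ d :* (con ½ :* h)) refl lo (c + 1ℚ) (½ ^ k))

  -- Clipping at 0 makes every term admissible for bisect; for a positive real
  -- it affects only finitely many terms.
  rootSeq : ℝ → ℕ → ℚ
  rootSeq x k = proj₁ (bisect n (0ℚ ⊔ seq x k) k)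

  narrow : ∀ x {ε} → 0ℚ < ε → ∃[ N ] ∀ {k} → N ℕ.≤ k →
           0ℚ ⊔ seq x k ≤ (rootSeq x k + ε) ^ n
  narrow x {ε} 0<ε =
    let B , 0<B , M , hB = bounded x
        N , hN = ½^-limit (B + 1ℚ) 0<ε
    in M ℕ.⊔ N , λ {k} ≤k → narrow-at (seq x k) k
      (⊔-lub (<⇒≤ 0<B) (≤-trans (p≤∣p∣ (seq x k)) (hB (ℕ.m⊔n≤o⇒m≤o M N ≤k))))
      (hN (ℕ.m⊔n≤o⇒n≤o M N ≤k))
    where
    narrow-at : ∀ q k {B} → 0ℚ ⊔ q ≤ B → (B + 1ℚ) * ½ ^ k ≤ ε →
                0ℚ ⊔ q ≤ (proj₁ (bisect n (0ℚ ⊔ q) k) + ε) ^ n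
    narrow-at q k {B} c≤B small = begin
      0ℚ ⊔ q                             ≤⟨ Bracket.≤hi^ b ⟩
      proj₂ (bisect n (0ℚ ⊔ q) k) ^ n    ≡⟨ cong (_^ n) (Bracket.width b) ⟩
      (lo + w) ^ n                       ≤⟨ ^-mono-≤ {lo + w} {lo + ε} n 0≤lo+w (+-monoʳ-≤ lo w≤ε) ⟩
      (lo + ε) ^ n                       ∎
      where
      lo = proj₁ (bisect n (0ℚ ⊔ q) k)
      w  = ((0ℚ ⊔ q) + 1ℚ) * ½ ^ k
      b  = bisect-bracket (p≤p⊔q 0ℚ q) k
      0≤½^k : 0ℚ ≤ ½ ^ k
      0≤½^k = 0≤^ k (<⇒≤ (positive⁻¹ ½))
      0≤lo+w : 0ℚ ≤ lo + w
      0≤lo+w = ≤-trans (Bracket.0≤lo b) (p≤p+q {lo} {w}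
        (0≤p*q {(0ℚ ⊔ q) + 1ℚ} (≤-trans (p≤p⊔q 0ℚ q) (p≤p+q {0ℚ ⊔ q} 0≤1)) 0≤½^k))
      w≤ε : w ≤ ε
      w≤ε = ≤-trans (*-monoʳ-≤-nonNeg (½ ^ k) {{nonNegative 0≤½^k}} (+-monoˡ-≤ 1ℚ c≤B)) small

  0≤rootSeq : ∀ x k → 0ℚ ≤ rootSeq x k
  0≤rootSeq x k = Bracket.0≤lo (bisect-bracket (p≤p⊔q 0ℚ (seq x k)) k)

  rootSeq^≤ : ∀ x k → rootSeq x k ^ n ≤ 0ℚ ⊔ seq x k
  rootSeq^≤ x k = Bracket.lo^≤ (bisect-bracket (p≤p⊔q 0ℚ (seq x k)) k)

  rootʳ : ℝ → ℝ
  rootʳ x = record { seq = rootSeq x ; cauchy = cauchy-root }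
    where
    cauchy-root : ∀ {ε} → 0ℚ < ε → ∃[ N ] ∀ {k l} → N ℕ.≤ k → N ℕ.≤ l →
                  ∣ rootSeq x k - rootSeq x l ∣ ≤ ε
    cauchy-root {ε} 0<ε = M ℕ.⊔ N , λ ≤k ≤l → ∣-∣≤ (dist ≤k ≤l) (dist ≤l ≤k)
      where
      η = ½ * ε
      0<η = 0<½* 0<ε
      M = proj₁ (cauchy x (0<^ n 0<η))
      N = proj₁ (narrow x 0<η)
      dist : ∀ {k l} → M ℕ.⊔ N ℕ.≤ k → M ℕ.⊔ N ℕ.≤ l → rootSeq x k ≤ rootSeq x l + ε
      dist {k} {l} ≤k ≤l = begin
        rootSeq x k            ≤⟨ ^-cancel-≤ n (≤-trans (0≤rootSeq x l)
                                    (≤-trans (p≤p+q (<⇒≤ 0<η)) (p≤p+q (<⇒≤ 0<η)))) (begin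
          rootSeq x k ^ n                ≤⟨ rootSeq^≤ x k ⟩
          0ℚ ⊔ seq x k                   ≤⟨ 0⊔-mono (seq x k) (seq x l) (<⇒≤ (0<^ n 0<η))
                                              (∣-∣≤⇒≤ (proj₂ (cauchy x (0<^ n 0<η))
                                                (ℕ.m⊔n≤o⇒m≤o M N ≤k) (ℕ.m⊔n≤o⇒m≤o M N ≤l))) ⟩
          (0ℚ ⊔ seq x l) + η ^ n         ≤⟨ +-monoˡ-≤ (η ^ n) (proj₂ (narrow x 0<η) (ℕ.m⊔n≤o⇒n≤o M N ≤l)) ⟩
          (rootSeq x l + η) ^ n + η ^ n  ≤⟨ ^-superadditive n (≤-trans (0≤rootSeq x l) (p≤p+q (<⇒≤ 0<η))) (<⇒≤ 0<η) ⟩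
          (rootSeq x l + η + η) ^ n      ∎) ⟩
        rootSeq x l + η + η    ≡⟨ +-assoc (rootSeq x l) η η ⟩
        rootSeq x l + (η + η)  ≡⟨ cong (rootSeq x l +_) (½+½ ε) ⟩
        rootSeq x l + ε        ∎

  rootʳ-pos : ∀ x → 0ʳ <ʳ x → 0ʳ <ʳ rootʳ x
  rootʳ-pos x (ε , 0<ε , M , hx) = ½ * δ , 0<½* 0<δ , M ℕ.⊔ N , λ {k} ≤k →
    let r = rootSeq x k
        δ≤ = ^-cancel-≤ n (≤-trans (0≤rootSeq x k) (p≤p+q (<⇒≤ (0<½* 0<δ)))) (begin
          δ ^ n            ≤⟨ p^n≤p n (<⇒≤ 0<δ) (p⊓q≤q ε 1ℚ) ⟩
          δ                ≤⟨ p⊓q≤p ε 1ℚ ⟩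
          ε                ≡⟨ sym (+-identityˡ ε) ⟩
          0ℚ + ε           ≤⟨ hx (ℕ.m⊔n≤o⇒m≤o M N ≤k) ⟩
          seq x k          ≤⟨ p≤q⊔p 0ℚ (seq x k) ⟩
          0ℚ ⊔ seq x k     ≤⟨ proj₂ (narrow x (0<½* 0<δ)) (ℕ.m⊔n≤o⇒n≤o M N ≤k) ⟩
          (r + ½ * δ) ^ n  ∎)
    in begin
      0ℚ + ½ * δ          ≡⟨ solve 1 (λ d → con 0ℚ :+ con ½ :* d := d :- con ½ :* d) refl δ ⟩
      δ - ½ * δ           ≤⟨ +-monoˡ-≤ (- (½ * δ)) δ≤ ⟩
      r + ½ * δ - ½ * δ   ≡⟨ solve 2 (λ r h → r :+ h :- h := r) refl r (½ * δ) ⟩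
      r                   ∎
    where
    δ = ε ⊓ 1ℚ
    0<δ : 0ℚ < δ
    0<δ = 0<p⊓q 0<ε 0<1
    N = proj₁ (narrow x (0<½* 0<δ))

infix 8 √[_]_

√[_]_ : ∀ n .{{_ : ℕ.NonZero n}} → ℝ₊ → ℝ₊
√[ n ] (x , 0<x) = rootʳ n x , rootʳ-pos n x 0<x

·-rawMonoid : RawMonoid 0ℓ 0ℓ
·-rawMonoid = record { Carrier = ℝ₊ ; _≈_ = _≈₊_ ; _∙_ = _·_ ; ε = 1₊ }

open Algebra.Definitions.RawMonoid ·-rawMonoid public using () renaming (sum to ∏)

PCMatrix : ℕ → Set
PCMatrix n = Fin n → Fin n → ℝ₊

Reciprocal : ∀ {n} → PCMatrix n → Set
Reciprocal c = ∀ i j → c i j · c j i ≈₊ 1₊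

module _ {n : ℕ} .{{_ : ℕ.NonZero n}} (c : PCMatrix n) where

  triadRatio : Fin n → Fin n → Fin n → ℝ₊
  triadRatio i j k = (c i j ÷₊ (c i k · c k j)) ⊓₊ ((c i k · c k j) ÷₊ c i j)

  KI : ℝ
  KI = max λ i → max λ j → max λ k → 1ʳ -ʳ value (triadRatio i j k)

  KI<1 : KI <ʳ 1ʳ
  KI<1 = max-<ʳ _ {1ʳ} λ i → max-<ʳ _ {1ʳ} λ j → max-<ʳ _ {1ʳ} λ k →
    1-x<1 (triadRatio i j k)

  1-KI : ℝ₊
  1-KI = (1ʳ -ʳ KI) , x<1⇒0<1-x KI KI<1

  geometricMean : Fin n → ℝ₊
  geometricMean i = √[ n ] ∏ λ r → c i r

  priority : Fin n → ℝ₊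
  priority i = δ · geometricMean i
    where
    δ : ℝ₊
    δ = ∏ λ s → geometricMean s ⁻¹

{-# OPTIONS --safe #-}
module Submission where

-- By definition of KI, every path product c i r · c r j lies between
-- (1 - KI) · c i j and c i j ÷ (1 - KI).  Hence the first hypothesis gives
-- c i r · c r j > 1, that is c i r > c j r, for every r, and the third one gives
-- c i r · c r j > c k r · c r l, that is c i r · c l r > c k r · c j r, for every r.
-- Multiplying over r and taking n-th roots compares the geometric means.  All of
-- this takes place in an ordered abelian group; the comparison of powers, where a
-- classical proof would use totality, needs only cotransitivity of the strict order.

open import Algebra.Bundles using (AbelianGroup; Group)
import Algebra.Definitions.RawMonoid
import Algebra.Properties.AbelianGroup
import Algebra.Properties.CommutativeMonoid.Mult
import Algebra.Properties.CommutativeMonoid.Sum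
import Algebra.Solver.CommutativeMonoid
open import Algebra.Structures using (IsAbelianGroup)
open import Data.Empty using (⊥-elim)
open import Data.Fin using (Fin; zero; suc)
open import Data.Nat using (ℕ; NonZero; zero; suc)
open import Data.Product using (_×_; _,_; proj₁; proj₂; swap)
open import Data.Sum using (_⊎_; inj₁; inj₂)
open import Data.Vec.Functional using (Vector)
open import Defs
open import Function using (_∘_)
open import Level using (0ℓ) renaming (suc to lsuc)
open import Relation.Binary
  using (Asymmetric; Cotransitive; IsEquivalence; IsPreorder; Rel; Trans; Transitive; _Respects₂_)
import Relation.Binary.Reasoning.Base.Triple
open import Relation.Nullary using (Dec; ¬_)

-- Ordered abelian groups with a cotransitive strict order.

-- Equality is incomparability for the strict order, so that congruence of the
-- operations is a consequence of monotonicity and need not be proved for the reals.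
record OrderedAbelianGroup ℓ : Set (lsuc ℓ) where
  infix  4 _≺_ _≼_ _≋_
  infixl 7 _∙_
  infix  8 _⁻¹ᴳ
  field
    Carrier  : Set ℓ
    _≺_      : Rel Carrier ℓ
    _∙_      : Carrier → Carrier → Carrier
    ε        : Carrier
    _⁻¹ᴳ     : Carrier → Carrier

  _≼_ : Rel Carrier ℓ
  x ≼ y = ¬ y ≺ x

  _≋_ : Rel Carrier ℓ
  x ≋ y = x ≼ y × y ≼ x

  field
    ≺-irrefl  : ∀ {x} → x ≼ x
    ≺-trans   : Transitive _≺_
    ≺-cotrans : Cotransitive _≺_
    ∙-monoˡ-≺ : ∀ z {x y} → x ≺ y → x ∙ z ≺ y ∙ z
    assoc     : ∀ x y z → (x ∙ y) ∙ z ≋ x ∙ (y ∙ z)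
    comm      : ∀ x y → x ∙ y ≋ y ∙ x
    identityʳ : ∀ x → x ∙ ε ≋ x
    -- Stated with x in place of ε, the inverse law yields cancellation of ≺,
    -- from which the congruence of _∙_ follows.
    //-cancel : ∀ x y → x ∙ y ∙ y ⁻¹ᴳ ≋ x

  ≺-asym : Asymmetric _≺_
  ≺-asym x≺y y≺x = ≺-irrefl (≺-trans x≺y y≺x)

  -- Cotransitivity at `z` leaves two sides, and `y ≼ z`, being a negation, refutes one of them; no
  -- decision between `x` and `z` is made.
  ≺-≼-trans : Trans _≺_ _≼_ _≺_
  ≺-≼-trans {k = z} x≺y y≼z with ≺-cotrans x≺y z
  ... | inj₁ x≺z = x≺z
  ... | inj₂ z≺y = ⊥-elim (y≼z z≺y)

  ≼-≺-trans : Trans _≼_ _≺_ _≺_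
  ≼-≺-trans {i = x} x≼y y≺z with ≺-cotrans y≺z x
  ... | inj₁ y≺x = ⊥-elim (x≼y y≺x)
  ... | inj₂ x≺z = x≺z

  ≼-trans : Transitive _≼_
  ≼-trans x≼y y≼z z≺x = y≼z (≺-≼-trans z≺x x≼y)

  ≋-isEquivalence : IsEquivalence _≋_
  ≋-isEquivalence = record
    { refl  = ≺-irrefl , ≺-irrefl
    ; sym   = swap
    ; trans = λ (x≼y , y≼x) (y≼z , z≼y) → ≼-trans x≼y y≼z , ≼-trans z≼y y≼x
    }

  ≼-isPreorder : IsPreorder _≋_ _≼_
  ≼-isPreorder = record
    { isEquivalence = ≋-isEquivalence
    ; reflexive     = proj₁
    ; trans         = ≼-trans
    }

  ≺-resp-≋ : _≺_ Respects₂ _≋_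
  ≺-resp-≋ = (λ y≋z x≺y → ≺-≼-trans x≺y (proj₁ y≋z))
           , (λ y≋z y≺x → ≼-≺-trans (proj₂ y≋z) y≺x)

  module ≼-Reasoning = Relation.Binary.Reasoning.Base.Triple
    -- The second `≺-asym` answers the demand that `≺` imply `≼`: since `x ≼ y` is the negation of
    -- `y ≺ x`, that is asymmetry again.
    ≼-isPreorder ≺-asym ≺-trans ≺-resp-≋ ≺-asym ≺-≼-trans ≼-≺-trans

  open ≼-Reasoning

  ∙-cancelʳ-≺ : ∀ z {x y} → x ∙ z ≺ y ∙ z → x ≺ y
  ∙-cancelʳ-≺ z {x} {y} xz≺yz = begin-strict
    x               ≈⟨ //-cancel x z ⟨
    x ∙ z ∙ z ⁻¹ᴳ   <⟨ ∙-monoˡ-≺ (z ⁻¹ᴳ) xz≺yz ⟩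
    y ∙ z ∙ z ⁻¹ᴳ   ≈⟨ //-cancel y z ⟩
    y               ∎

  -- Contrapositive of cancellation for `≺`.
  ∙-monoˡ-≼ : ∀ z {x y} → x ≼ y → x ∙ z ≼ y ∙ z
  ∙-monoˡ-≼ z x≼y = x≼y ∘ ∙-cancelʳ-≺ z

  ∙-monoʳ-≺ : ∀ z {x y} → x ≺ y → z ∙ x ≺ z ∙ y
  ∙-monoʳ-≺ z {x} {y} x≺y = begin-strict
    z ∙ x  ≈⟨ comm z x ⟩
    x ∙ z  <⟨ ∙-monoˡ-≺ z x≺y ⟩
    y ∙ z  ≈⟨ comm y z ⟩
    z ∙ y  ∎

  ∙-mono-≺ : ∀ {x y u v} → x ≺ y → u ≺ v → x ∙ u ≺ y ∙ v
  ∙-mono-≺ {y = y} {u = u} x≺y u≺v = ≺-trans (∙-monoˡ-≺ u x≺y) (∙-monoʳ-≺ y u≺v)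

  ∙-cancelˡ-≺ : ∀ z {x y} → z ∙ x ≺ z ∙ y → x ≺ y
  ∙-cancelˡ-≺ z {x} {y} zx≺zy = ∙-cancelʳ-≺ z (begin-strict
    x ∙ z  ≈⟨ comm x z ⟩
    z ∙ x  <⟨ zx≺zy ⟩
    z ∙ y  ≈⟨ comm z y ⟩
    y ∙ z  ∎)

  ∙-monoʳ-≼ : ∀ z {x y} → x ≼ y → z ∙ x ≼ z ∙ y
  ∙-monoʳ-≼ z x≼y = x≼y ∘ ∙-cancelˡ-≺ z

  abelianGroup : AbelianGroup ℓ ℓ
  abelianGroup = record { isAbelianGroup = isAbelianGroup }
    where
    open IsEquivalence ≋-isEquivalence using (trans)
    inverseʳ : ∀ x → x ∙ x ⁻¹ᴳ ≋ ε
    inverseʳ x = begin-equality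
      -- Congruence of `_∙_` is still to be packaged here, so the equality is assembled from
      -- monotonicity in both directions.
      x ∙ x ⁻¹ᴳ      ≈⟨ ∙-monoˡ-≼ (x ⁻¹ᴳ) (proj₂ εx≋x) , ∙-monoˡ-≼ (x ⁻¹ᴳ) (proj₁ εx≋x) ⟩
      ε ∙ x ∙ x ⁻¹ᴳ  ≈⟨ //-cancel ε x ⟩
      ε              ∎
      where
      εx≋x : ε ∙ x ≋ x
      εx≋x = trans (comm ε x) (identityʳ x)
    isAbelianGroup : IsAbelianGroup _≋_ _∙_ ε _⁻¹ᴳ
    isAbelianGroup = record
      { isGroup = record
        { isMonoid = record
          { isSemigroup = record
            { isMagma = record
              { isEquivalence = ≋-isEquivalence
              ; ∙-cong = λ {x} {y} {u} {v} (x≼y , y≼x) (u≼v , v≼u) →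
                  ≼-trans (∙-monoˡ-≼ u x≼y) (∙-monoʳ-≼ y u≼v) ,
                  ≼-trans (∙-monoˡ-≼ v y≼x) (∙-monoʳ-≼ x v≼u)
              }
            ; assoc = assoc
            }
          ; identity = (λ x → trans (comm ε x) (identityʳ x)) , identityʳ
          }
        ; inverse = (λ x → trans (comm (x ⁻¹ᴳ) x) (inverseʳ x)) , inverseʳ
        ; ⁻¹-cong = λ {x} {y} x≋y → ⁻¹-anti (proj₂ x≋y) , ⁻¹-anti (proj₁ x≋y)
        }
      ; comm = comm
      }
      where
      ⁻¹-anti : ∀ {x y} → x ≼ y → y ⁻¹ᴳ ≼ x ⁻¹ᴳ
      ⁻¹-anti {x} {y} x≼y x⁻¹≺y⁻¹ = ≺-irrefl (begin-strict
        ε          ≈⟨ inverseʳ x ⟨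
        x ∙ x ⁻¹ᴳ  ≤⟨ ∙-monoˡ-≼ (x ⁻¹ᴳ) x≼y ⟩
        y ∙ x ⁻¹ᴳ  <⟨ ∙-monoʳ-≺ y x⁻¹≺y⁻¹ ⟩
        y ∙ y ⁻¹ᴳ  ≈⟨ inverseʳ y ⟩
        ε          ∎)

-- Comparison of geometric means in an ordered abelian group.

module GeometricMean {ℓ} (G : OrderedAbelianGroup ℓ) where
  open OrderedAbelianGroup G
  open AbelianGroup abelianGroup using (commutativeMonoid; group; ∙-congˡ; ∙-congʳ; refl; trans)
  open Group group using (_//_)
  open Algebra.Properties.AbelianGroup abelianGroup using (//-rightDividesˡ)
  open Algebra.Properties.CommutativeMonoid.Mult commutativeMonoid
    using (×-distrib-+) renaming (_×_ to _⋆_)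
  open Algebra.Properties.CommutativeMonoid.Sum commutativeMonoid using (∑-distrib-+; sum)
  open Algebra.Solver.CommutativeMonoid commutativeMonoid using (solve; _⊕_; _⊜_)
  open ≼-Reasoning

  x≺y//z⇒x∙z≺y : ∀ {x y} z → x ≺ y // z → x ∙ z ≺ y
  x≺y//z⇒x∙z≺y {x} {y} z x≺y//z = begin-strict
    x ∙ z         <⟨ ∙-monoˡ-≺ z x≺y//z ⟩
    (y // z) ∙ z  ≈⟨ //-rightDividesˡ z y ⟩
    y             ∎

  x//z≺y⇒x≺y∙z : ∀ {x y} z → x // z ≺ y → x ≺ y ∙ z
  x//z≺y⇒x≺y∙z {x} {y} z x//z≺y = begin-strict
    x             ≈⟨ //-rightDividesˡ z x ⟨
    (x // z) ∙ z  <⟨ ∙-monoˡ-≺ z x//z≺y ⟩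
    y ∙ z         ∎

  x≼y//z⇒x∙z≼y : ∀ {x y} z → x ≼ y // z → x ∙ z ≼ y
  x≼y//z⇒x∙z≼y {x} {y} z x≼y//z = begin
    x ∙ z         ≤⟨ ∙-monoˡ-≼ z x≼y//z ⟩
    (y // z) ∙ z  ≈⟨ //-rightDividesˡ z y ⟩
    y             ∎

  x∙v≺u∙y⇒x//y≺u//v : ∀ {x u} y v → x ∙ v ≺ u ∙ y → x // y ≺ u // v
  x∙v≺u∙y⇒x//y≺u//v {x} {u} y v xv≺uy = ∙-cancelʳ-≺ (y ∙ v) (begin-strict
    (x // y) ∙ (y ∙ v)  ≈⟨ assoc (x // y) y v ⟨
    (x // y) ∙ y ∙ v    ≈⟨ ∙-congʳ (//-rightDividesˡ y x) ⟩
    x ∙ v               <⟨ xv≺uy ⟩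
    u ∙ y               ≈⟨ ∙-congʳ (//-rightDividesˡ v u) ⟨
    (u // v) ∙ v ∙ y    ≈⟨ solve 3 (λ a b c → (a ⊕ b) ⊕ c ⊜ a ⊕ (c ⊕ b)) refl (u // v) v y ⟩
    (u // v) ∙ (y ∙ v)  ∎)

  sum-mono-≺ : ∀ {n} .{{_ : NonZero n}} {f g : Vector Carrier n} → (∀ i → f i ≺ g i) → sum f ≺ sum g
  -- The recursion stops at length one, because two empty sums are never strictly ordered; a
  -- one-term sum still carries a trailing `ε`.
  sum-mono-≺ {suc zero}    f≺g = ∙-monoˡ-≺ ε (f≺g zero)
  sum-mono-≺ {suc (suc n)} f≺g = ∙-mono-≺ (f≺g zero) (sum-mono-≺ (f≺g ∘ suc))

  -- The mixed element `y ∙ n ⋆ x` is placed between the two multiples. If it lies above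
  -- `suc n ⋆ x`, cancelling `n ⋆ x` finishes; if it lies below `suc n ⋆ y`, cancelling `y` leaves
  -- the same claim for `n`.
  ⋆-cancelˡ-≺ : ∀ n {x y} → n ⋆ x ≺ n ⋆ y → x ≺ y
  ⋆-cancelˡ-≺ zero ε≺ε = ⊥-elim (≺-irrefl ε≺ε)
  ⋆-cancelˡ-≺ (suc n) {x} {y} h with ≺-cotrans h (y ∙ n ⋆ x)
  ... | inj₁ x≺y = ∙-cancelʳ-≺ (n ⋆ x) x≺y
  ... | inj₂ nx≺ny = ⋆-cancelˡ-≺ n (∙-cancelˡ-≺ y nx≺ny)

  -- Here `μ` plays the part of 1 - KI(C), entering only through its two bounds, and `g` is any
  -- choice of n-th roots of the row products.
  module _ {n : ℕ} .{{_ : NonZero n}} (c : Fin n → Fin n → Carrier)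
           (reciprocal : ∀ i j → c i j ∙ c j i ≋ ε)
           (μ : Carrier)
           (μ≼direct//path : ∀ i j k → μ ≼ c i j // (c i k ∙ c k j))
           (μ≼path//direct : ∀ i j k → μ ≼ (c i k ∙ c k j) // c i j)
           (g : Fin n → Carrier)
           (g-root : ∀ i → n ⋆ g i ≋ sum (c i))
    where

    g-mono : ∀ i j → ε // μ ≺ c i j → g j ≺ g i
    g-mono i j ε//μ≺cij = ⋆-cancelˡ-≺ n (begin-strict
      n ⋆ g j   ≈⟨ g-root j ⟩
      sum (c j) <⟨ sum-mono-≺ cjr≺cir ⟩
      sum (c i) ≈⟨ g-root i ⟨
      n ⋆ g i   ∎)
      where
      cjr≺cir : ∀ r → c j r ≺ c i r
      cjr≺cir r = ∙-cancelʳ-≺ (c r j) (begin-strict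
        c j r ∙ c r j  ≈⟨ reciprocal j r ⟩
        ε              <⟨ x//z≺y⇒x≺y∙z μ ε//μ≺cij ⟩
        c i j ∙ μ      ≈⟨ comm (c i j) μ ⟩
        μ ∙ c i j      ≤⟨ x≼y//z⇒x∙z≼y (c i j) (μ≼path//direct i j r) ⟩
        c i r ∙ c r j  ∎)

    -- This is the comparison of `g k // g l` with `g i // g j`, multiplied out so that the root
    -- property applies to products. Of the two factors `ε // μ`, one pays for replacing `c k l` by
    -- a path, the other for replacing `c i j`.
    g-ratio-mono : ∀ i j k l → (ε // μ) ∙ (ε // μ) ≺ c i j // c k l → g k ∙ g j ≺ g i ∙ g l
    g-ratio-mono i j k l h = ⋆-cancelˡ-≺ n (begin-strict
      n ⋆ (g k ∙ g j)            ≈⟨ ⋆-root k j ⟩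
      sum (λ r → c k r ∙ c j r)  <⟨ sum-mono-≺ ckr∙cjr≺cir∙clr ⟩
      sum (λ r → c i r ∙ c l r)  ≈⟨ ⋆-root i l ⟨
      n ⋆ (g i ∙ g l)            ∎)
      where
      ⋆-root : ∀ i j → n ⋆ (g i ∙ g j) ≋ sum (λ r → c i r ∙ c j r)
      ⋆-root i j = begin-equality
        n ⋆ (g i ∙ g j)            ≈⟨ ×-distrib-+ (g i) (g j) n ⟩
        n ⋆ g i ∙ n ⋆ g j          ≈⟨ ∙-congʳ (g-root i) ⟩
        sum (c i) ∙ n ⋆ g j        ≈⟨ ∙-congˡ (g-root j) ⟩
        sum (c i) ∙ sum (c j)      ≈⟨ ∑-distrib-+ (c i) (c j) ⟨
        sum (λ r → c i r ∙ c j r)  ∎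

      ckl≺μμcij : c k l ≺ μ ∙ (μ ∙ c i j)
      ckl≺μμcij = begin-strict
        c k l                                          ≈⟨ identityʳ (c k l) ⟨
        c k l ∙ ε                                      ≈⟨ ∙-congˡ (identityʳ ε) ⟨
        -- The solver knows only the commutative monoid laws, so each `ε` is expanded by hand into
        -- `(ε // μ) ∙ μ` before regrouping exposes the left side of `h`.
        c k l ∙ (ε ∙ ε)                                ≈⟨ ∙-congˡ (trans (∙-congʳ ε//μ∙μ) (∙-congˡ ε//μ∙μ)) ⟨
        c k l ∙ (((ε // μ) ∙ μ) ∙ ((ε // μ) ∙ μ))
          ≈⟨ solve 3 (λ k m u → k ⊕ ((m ⊕ u) ⊕ (m ⊕ u)) ⊜ ((m ⊕ m) ⊕ k) ⊕ (u ⊕ u)) refl (c k l) (ε // μ) μ ⟩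
        (ε // μ) ∙ (ε // μ) ∙ c k l ∙ (μ ∙ μ)          <⟨ ∙-monoˡ-≺ (μ ∙ μ) (x≺y//z⇒x∙z≺y (c k l) h) ⟩
        c i j ∙ (μ ∙ μ)                                ≈⟨ solve 2 (λ d u → d ⊕ (u ⊕ u) ⊜ u ⊕ (u ⊕ d)) refl (c i j) μ ⟩
        μ ∙ (μ ∙ c i j)                                ∎
        where
        ε//μ∙μ : (ε // μ) ∙ μ ≋ ε
        ε//μ∙μ = //-rightDividesˡ μ ε

      path≺path : ∀ r → c k r ∙ c r l ≺ c i r ∙ c r j
      path≺path r = ∙-cancelˡ-≺ μ (begin-strict
        μ ∙ (c k r ∙ c r l)  ≤⟨ x≼y//z⇒x∙z≼y (c k r ∙ c r l) (μ≼direct//path k l r) ⟩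
        c k l                <⟨ ckl≺μμcij ⟩
        μ ∙ (μ ∙ c i j)      ≤⟨ ∙-monoʳ-≼ μ (x≼y//z⇒x∙z≼y (c i j) (μ≼path//direct i j r)) ⟩
        μ ∙ (c i r ∙ c r j)  ∎)

      ckr∙cjr≺cir∙clr : ∀ r → c k r ∙ c j r ≺ c i r ∙ c l r
      -- The common factor `c r l ∙ c r j` completes both paths; by reciprocity the leftover pairs
      -- `c j r ∙ c r j` and `c l r ∙ c r l` are trivial.
      ckr∙cjr≺cir∙clr r = ∙-cancelʳ-≺ (c r l ∙ c r j) (begin-strict
        c k r ∙ c j r ∙ (c r l ∙ c r j)
          ≈⟨ solve 4 (λ k j l j′ → (k ⊕ j) ⊕ (l ⊕ j′) ⊜ (k ⊕ l) ⊕ (j ⊕ j′)) refl (c k r) (c j r) (c r l) (c r j) ⟩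
        c k r ∙ c r l ∙ (c j r ∙ c r j)  ≈⟨ ∙-congˡ (reciprocal j r) ⟩
        c k r ∙ c r l ∙ ε                <⟨ ∙-monoˡ-≺ ε (path≺path r) ⟩
        c i r ∙ c r j ∙ ε                ≈⟨ ∙-congˡ (reciprocal l r) ⟨
        c i r ∙ c r j ∙ (c l r ∙ c r l)
          ≈⟨ solve 4 (λ i j l l′ → (i ⊕ j) ⊕ (l ⊕ l′) ⊜ (i ⊕ l) ⊕ (l′ ⊕ j)) refl (c i r) (c r j) (c l r) (c r l) ⟩
        c i r ∙ c l r ∙ (c r l ∙ c r j)  ∎)

    -- A common factor `δ` never affects the comparisons: it appears once on each side of the first
    -- two and, after cross-multiplication, squared on each side of the third.
    g-order-preservation : ∀ δ i j k l →
      ε // μ ≺ c i j → ε // μ ≺ c k l → (ε // μ) ∙ (ε // μ) ≺ c i j // c k l →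
      (δ ∙ g j ≺ δ ∙ g i) × (δ ∙ g l ≺ δ ∙ g k) ×
      ((δ ∙ g k) // (δ ∙ g l) ≺ (δ ∙ g i) // (δ ∙ g j))
    g-order-preservation δ i j k l hij hkl h =
      ∙-monoʳ-≺ δ (g-mono i j hij) ,
      ∙-monoʳ-≺ δ (g-mono k l hkl) ,
      x∙v≺u∙y⇒x//y≺u//v (δ ∙ g l) (δ ∙ g j) (begin-strict
        δ ∙ g k ∙ (δ ∙ g j)  ≈⟨ regroup (g k) (g j) ⟩
        δ ∙ δ ∙ (g k ∙ g j)  <⟨ ∙-monoʳ-≺ (δ ∙ δ) (g-ratio-mono i j k l h) ⟩
        δ ∙ δ ∙ (g i ∙ g l)  ≈⟨ regroup (g i) (g l) ⟨
        δ ∙ g i ∙ (δ ∙ g l)  ∎)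
      where
      regroup : ∀ x y → δ ∙ x ∙ (δ ∙ y) ≋ δ ∙ δ ∙ (x ∙ y)
      regroup = solve 3 (λ d x y → (d ⊕ x) ⊕ (d ⊕ y) ⊜ (d ⊕ d) ⊕ (x ⊕ y)) refl δ

-- The positive Cauchy reals as an ordered abelian group.

module PositiveReals where
  open import Data.Rational hiding (NonZero)
  open import Data.Rational.Properties
  open import Data.Rational.Solver using (module +-*-Solver)
  import Data.Nat as ℕ
  import Data.Nat.Properties as ℕ
  open import Data.Product using (∃-syntax)
  open import Relation.Binary.PropositionalEquality using (_≡_; refl; sym; cong; cong₂)
  open import Relation.Nullary using (yes; no)
  open ℚ-facts
  open ≤-Reasoning
  open +-*-Solver

  +-cancelʳ-≤ : ∀ r {p q} → p + r ≤ q + r → p ≤ q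
  +-cancelʳ-≤ r {p} {q} p+r≤q+r = begin
    p          ≡⟨ solve 2 (λ p r → p := p :+ r :- r) refl p r ⟩
    p + r - r  ≤⟨ +-monoˡ-≤ (- r) p+r≤q+r ⟩
    q + r - r  ≡⟨ solve 2 (λ q r → q :+ r :- r := q) refl q r ⟩
    q          ∎

  p+q≤p⇒q≤0 : ∀ {p q} → p + q ≤ p → q ≤ 0ℚ
  p+q≤p⇒q≤0 {p} {q} p+q≤p = +-cancelʳ-≤ p (begin
    q + p   ≡⟨ +-comm q p ⟩
    p + q   ≤⟨ p+q≤p ⟩
    p       ≡⟨ +-identityˡ p ⟨
    0ℚ + p  ∎)

  -- A strict inequality keeps a fixed positive gap at all late indices, so one index beyond both
  -- thresholds refutes it.
  eventually-≤⇒≯ : ∀ x y → ∃[ N ] (∀ {n} → N ℕ.≤ n → seq x n ≤ seq y n) → ¬ y <ʳ x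
  eventually-≤⇒≯ x y (M , x≤y) (ε , 0<ε , N , y<x) = <-irrefl refl (<-≤-trans 0<ε
    (p+q≤p⇒q≤0 {seq y n} (≤-trans (y<x (ℕ.m≤n⊔m M N)) (x≤y (ℕ.m≤m⊔n M N)))))
    where n = M ℕ.⊔ N

  eventually-≡⇒≯≮ : ∀ x y → ∃[ N ] (∀ {n} → N ℕ.≤ n → seq x n ≡ seq y n) →
                    ¬ y <ʳ x × ¬ x <ʳ y
  eventually-≡⇒≯≮ x y (N , x≡y) =
    eventually-≤⇒≯ x y (N , ≤-reflexive ∘ x≡y) ,
    eventually-≤⇒≯ y x (N , ≤-reflexive ∘ sym ∘ x≡y)

  -- Closeness to within half the gap leaves the other half as a contradiction.
  ≈⇒≯ : ∀ x y → x ≈ y → ¬ y <ʳ x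
  ≈⇒≯ x y x≈y (ε , 0<ε , N , y<x) = <-irrefl refl (<-≤-trans (0<½* 0<ε)
    (p+q≤p⇒q≤0 {seq y n + ½ * ε} (begin
      seq y n + ½ * ε + ½ * ε    ≡⟨ +-assoc (seq y n) (½ * ε) (½ * ε) ⟩
      seq y n + (½ * ε + ½ * ε)  ≡⟨ cong (seq y n +_) (½+½ ε) ⟩
      seq y n + ε                ≤⟨ y<x (ℕ.m≤n⊔m M N) ⟩
      seq x n                    ≤⟨ ∣-∣≤⇒≤ (proj₂ (x≈y (0<½* 0<ε)) (ℕ.m≤m⊔n M N)) ⟩
      seq y n + ½ * ε            ∎)))
    where
    M = proj₁ (x≈y (0<½* 0<ε))
    n = M ℕ.⊔ N

  ≈-sym : ∀ x y → x ≈ y → y ≈ x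
  ≈-sym x y x≈y 0<ε with x≈y 0<ε
  ... | N , h = N , λ {n} N≤n → ≤-trans (≤-reflexive (∣p-q∣≡∣q-p∣ (seq y n) (seq x n))) (h N≤n)

  <ʳ-trans : ∀ x y z → x <ʳ y → y <ʳ z → x <ʳ z
  <ʳ-trans x y z (ε , 0<ε , M , x<y) (η , 0<η , N , y<z) = ε , 0<ε , M ℕ.⊔ N , λ {n} ≤n → begin
    seq x n + ε  ≤⟨ x<y (ℕ.m⊔n≤o⇒m≤o M N ≤n) ⟩
    seq y n      ≤⟨ p≤p+q (<⇒≤ 0<η) ⟩
    seq y n + η  ≤⟨ y<z (ℕ.m⊔n≤o⇒n≤o M N ≤n) ⟩
    seq z n      ∎

  -- Comparing y with x + ½ ε at a single late index decides the side: the later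
  -- drift of the sequences costs at most a quarter of the gap ε.
  <ʳ-cotrans : Cotransitive _<ʳ_
  <ʳ-cotrans {x} {z} (ε , 0<ε , N , x<z) y = decide (seq y m ≤? seq x m + ½ * ε)
    where
    -- An eighth of `ε`: two drifts of `η` together with the new gap of a quarter use up exactly
    -- `½ * ε` in either case.
    η = ½ * (½ * (½ * ε))
    0<2η = 0<½* (0<½* 0<ε)
    0<η = 0<½* 0<2η
    K = proj₁ (cauchy x 0<η)
    L = proj₁ (cauchy y 0<η)
    m = K ℕ.⊔ L
    near-x : ∀ {i j} → K ℕ.≤ i → K ℕ.≤ j → seq x i ≤ seq x j + η
    near-x i j = ∣-∣≤⇒≤ (proj₂ (cauchy x 0<η) i j)
    near-y : ∀ {i j} → L ℕ.≤ i → L ℕ.≤ j → seq y i ≤ seq y j + η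
    near-y i j = ∣-∣≤⇒≤ (proj₂ (cauchy y 0<η) i j)
    K≤m = ℕ.m≤m⊔n K L
    L≤m = ℕ.m≤n⊔m K L
    decide : Dec (seq y m ≤ seq x m + ½ * ε) → x <ʳ y ⊎ y <ʳ z
    decide (yes y≤) = inj₂ (½ * (½ * ε) , 0<2η , N ℕ.⊔ m , λ {n} ≤n →
      let N≤n = ℕ.m⊔n≤o⇒m≤o N m ≤n ; m≤n = ℕ.m⊔n≤o⇒n≤o N m ≤n in begin
      seq y n + ½ * (½ * ε)                        ≤⟨ +-monoˡ-≤ (½ * (½ * ε)) (near-y (ℕ.≤-trans L≤m m≤n) L≤m) ⟩
      seq y m + η + ½ * (½ * ε)                    ≤⟨ +-monoˡ-≤ (½ * (½ * ε)) (+-monoˡ-≤ η y≤) ⟩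
      seq x m + ½ * ε + η + ½ * (½ * ε)            ≤⟨ +-monoˡ-≤ (½ * (½ * ε)) (+-monoˡ-≤ η (+-monoˡ-≤ (½ * ε)
                                                      (near-x K≤m (ℕ.≤-trans K≤m m≤n)))) ⟩
      seq x n + η + ½ * ε + η + ½ * (½ * ε)
        ≡⟨ solve 2 (λ x e → let q = con ½ :* (con ½ :* e) in
             x :+ con ½ :* q :+ con ½ :* e :+ con ½ :* q :+ q := x :+ e) refl (seq x n) ε ⟩
      seq x n + ε                                  ≤⟨ x<z N≤n ⟩
      seq z n                                      ∎)
    decide (no y≰) = inj₁ (½ * (½ * ε) , 0<2η , m , λ {n} m≤n →
      +-cancelʳ-≤ η (begin
      seq x n + ½ * (½ * ε) + η      ≤⟨ +-monoˡ-≤ η (+-monoˡ-≤ (½ * (½ * ε)) (near-x (ℕ.≤-trans K≤m m≤n) K≤m)) ⟩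
      seq x m + η + ½ * (½ * ε) + η
        ≡⟨ solve 2 (λ x e → let q = con ½ :* (con ½ :* e) in
             x :+ con ½ :* q :+ q :+ con ½ :* q := x :+ con ½ :* e) refl (seq x m) ε ⟩
      seq x m + ½ * ε                ≤⟨ <⇒≤ (≰⇒> y≰) ⟩
      seq y m                        ≤⟨ near-y L≤m (ℕ.≤-trans L≤m m≤n) ⟩
      seq y n + η                    ∎))

  ·-monoˡ-< : ∀ z {x y} → x <₊ y → x · z <₊ y · z
  ·-monoˡ-< (z , η , 0<η , M , 0<z) {x , _} {y , _} (ε , 0<ε , N , x<y) =
    -- Late terms of `z` are at least `η`, so multiplication scales the gap `ε` by at least that
    -- much.
    ε * η , 0<p*q 0<ε 0<η , M ℕ.⊔ N , λ {n} ≤n →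
      let η≤z = ≤-trans (≤-reflexive (sym (+-identityˡ η))) (0<z (ℕ.m⊔n≤o⇒m≤o M N ≤n)) in begin
      seq x n * seq z n + ε * η        ≤⟨ +-monoʳ-≤ (seq x n * seq z n)
                                            (*-monoˡ-≤-nonNeg ε {{nonNegative (<⇒≤ 0<ε)}} η≤z) ⟩
      seq x n * seq z n + ε * seq z n  ≡⟨ *-distribʳ-+ (seq z n) (seq x n) ε ⟨
      (seq x n + ε) * seq z n          ≤⟨ *-monoʳ-≤-nonNeg (seq z n) {{nonNegative (≤-trans (<⇒≤ 0<η) η≤z)}}
                                            (x<y (ℕ.m⊔n≤o⇒n≤o M N ≤n)) ⟩
      seq y n * seq z n                ∎


  -- Equality is only eventual because `_⁻¹` replaces early terms by a lower bound; past `N` the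
  -- clipping is inactive.
  ÷₊-cancel : ∀ x y → ∃[ N ] (∀ {n} → N ℕ.≤ n → seq (value (x · y · y ⁻¹)) n ≡ seq (value x) n)
  ÷₊-cancel (x , _) (y , ε , 0<ε , N , 0<y) = N , λ {n} N≤n →
    let r = recip (ε ⊔ seq y n) (0<p⊔q (seq y n) 0<ε)
        ε≤y = ≤-trans (≤-reflexive (sym (+-identityˡ ε))) (0<y N≤n) in begin-equality
    seq x n * seq y n * r            ≡⟨ *-assoc (seq x n) (seq y n) r ⟩
    seq x n * (seq y n * r)          ≡⟨ cong (λ q → seq x n * (q * r)) (p≤q⇒p⊔q≡q ε≤y) ⟨
    seq x n * ((ε ⊔ seq y n) * r)    ≡⟨ cong (seq x n *_) (*-recip (ε ⊔ seq y n) (0<p⊔q (seq y n) 0<ε)) ⟩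
    seq x n * 1ℚ                     ≡⟨ *-identityʳ (seq x n) ⟩
    seq x n                          ∎

  orderedAbelianGroup : OrderedAbelianGroup 0ℓ
  orderedAbelianGroup = record
    { Carrier   = ℝ₊
    ; _≺_       = _<₊_
    ; _∙_       = _·_
    ; ε         = 1₊
    ; _⁻¹ᴳ      = _⁻¹
    ; ≺-irrefl  = λ {x} → eventually-≤⇒≯ (value x) (value x) (0 , λ _ → ≤-refl)
    ; ≺-trans   = λ {x} {y} {z} → <ʳ-trans (value x) (value y) (value z)
    ; ≺-cotrans = λ {x} {z} x<z y → <ʳ-cotrans {value x} {value z} x<z (value y)
    ; ∙-monoˡ-≺ = ·-monoˡ-<
    ; assoc     = λ x y z → eventually-≡⇒≯≮ (value (x · y · z)) (value (x · (y · z))) (0 , λ {n} _ →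
                    *-assoc (seq (value x) n) (seq (value y) n) (seq (value z) n))
    ; comm      = λ x y → eventually-≡⇒≯≮ (value (x · y)) (value (y · x)) (0 , λ {n} _ →
                    *-comm (seq (value x) n) (seq (value y) n))
    ; identityʳ = λ x → eventually-≡⇒≯≮ (value (x · 1₊)) (value x) (0 , λ {n} _ → *-identityʳ (seq (value x) n))
    ; //-cancel = λ x y → eventually-≡⇒≯≮ (value (x · y · y ⁻¹)) (value x) (÷₊-cancel x y)
    }

  -- Powers of n-th roots.

  open OrderedAbelianGroup orderedAbelianGroup using (_≼_; _≋_; abelianGroup)

  -- Bisection controls `(r + η) ^ n`, whereas the root property concerns `r ^ n`; a constant `K`
  -- uniform in `r` and `η` bridges the two.
  ^-lipschitz : ∀ n {B} → 0ℚ ≤ B → ∃[ K ] 0ℚ < K ×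
    (∀ {r η} → 0ℚ ≤ r → r ≤ B → 0ℚ ≤ η → η ≤ 1ℚ → (r + η) ^ n ≤ r ^ n + η * K)
  ^-lipschitz zero    0≤B = 1ℚ , 0<1 , λ {_} {η} _ _ 0≤η _ → p≤p+q (0≤p*q {η} 0≤η 0≤1)
  ^-lipschitz (suc n) {B} 0≤B =
    let K , 0<K , h = ^-lipschitz n 0≤B
        0<B+1 = <-≤-trans 0<1 (p≤q+p {1ℚ} {B} 0≤B)
    -- Expanding `(r + η) * (r ^ n + η * K)`, the coefficient of `η` is `(r + η) * K + r ^ n`,
    -- bounded through `r ≤ B` and `η ≤ 1`.
    in (B + 1ℚ) * K + B ^ n , 0<p+q (0<p*q 0<B+1 0<K) (0≤^ n 0≤B) ,
    λ {r} {η} 0≤r r≤B 0≤η η≤1 → begin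
      (r + η) * (r + η) ^ n
        ≤⟨ *-monoˡ-≤-nonNeg (r + η) {{nonNegative (≤-trans 0≤r (p≤p+q 0≤η))}} (h 0≤r r≤B 0≤η η≤1) ⟩
      (r + η) * (r ^ n + η * K)
        ≡⟨ solve 4 (λ r η p k → (r :+ η) :* (p :+ η :* k) := r :* p :+ η :* ((r :+ η) :* k :+ p)) refl r η (r ^ n) K ⟩
      r * r ^ n + η * ((r + η) * K + r ^ n)
        ≤⟨ +-monoʳ-≤ (r * r ^ n) (*-monoˡ-≤-nonNeg η {{nonNegative 0≤η}}
             (+-mono-≤ (*-monoʳ-≤-nonNeg K {{nonNegative (<⇒≤ 0<K)}} (+-mono-≤ r≤B η≤1)) (^-mono-≤ n 0≤r r≤B))) ⟩
      r * r ^ n + η * ((B + 1ℚ) * K + B ^ n) ∎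

  open Algebra.Definitions.RawMonoid (AbelianGroup.rawMonoid abelianGroup) using () renaming (_×_ to _⋆_)

  seq-⋆ : ∀ n x k → seq (value (n ⋆ x)) k ≡ seq (value x) k ^ n
  seq-⋆ zero    x k = refl
  seq-⋆ (suc n) x k = cong (seq (value x) k *_) (seq-⋆ n x k)

  -- The lower bisection endpoint has n-th power at most the clipped term, which gives one half. For
  -- the other, the upper endpoint is eventually within any `η`, and the Lipschitz bound makes the
  -- resulting error smaller than a supposed gap.
  √-⋆ : ∀ n .{{_ : NonZero n}} x → n ⋆ √[ n ] x ≋ x
  √-⋆ n x⁺@(x , ε₀ , 0<ε₀ , N₀ , 0<x) = eventually-≤⇒≯ (value (n ⋆ √[ n ] x⁺)) x upper , lower
    where
    clip : ∀ {k} → N₀ ℕ.≤ k → 0ℚ ⊔ seq x k ≡ seq x k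
    clip N₀≤k = p≤q⇒p⊔q≡q (≤-trans (<⇒≤ 0<ε₀) (≤-trans (≤-reflexive (sym (+-identityˡ ε₀))) (0<x N₀≤k)))

    upper : ∃[ N ] (∀ {k} → N ℕ.≤ k → seq (value (n ⋆ √[ n ] x⁺)) k ≤ seq x k)
    upper = N₀ , λ {k} N₀≤k → begin
      seq (value (n ⋆ √[ n ] x⁺)) k  ≡⟨ seq-⋆ n (√[ n ] x⁺) k ⟩
      rootSeq n x k ^ n              ≤⟨ rootSeq^≤ n x k ⟩
      0ℚ ⊔ seq x k                   ≡⟨ clip N₀≤k ⟩
      seq x k                        ∎

    lower : ¬ n ⋆ √[ n ] x⁺ <₊ x⁺
    lower (ε , 0<ε , M , r^n<x) = <-irrefl refl (<-≤-trans (0<½* 0<ε)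
      (p+q≤p⇒q≤0 {r ^ n + ½ * ε} (begin
        r ^ n + ½ * ε + ½ * ε              ≡⟨ +-assoc (r ^ n) (½ * ε) (½ * ε) ⟩
        r ^ n + (½ * ε + ½ * ε)            ≡⟨ cong₂ _+_ (sym (seq-⋆ n (√[ n ] x⁺) k)) (½+½ ε) ⟩
        seq (value (n ⋆ √[ n ] x⁺)) k + ε  ≤⟨ r^n<x (ℕ.m≤m⊔n M (L ℕ.⊔ N)) ⟩
        seq x k                            ≤⟨ p≤q⊔p 0ℚ (seq x k) ⟩
        0ℚ ⊔ seq x k                       ≤⟨ proj₂ (narrow n x 0<η) (ℕ.≤-trans (ℕ.m≤n⊔m L N) (ℕ.m≤n⊔m M (L ℕ.⊔ N))) ⟩
        (r + η) ^ n                        ≤⟨ proj₂ (proj₂ lipschitz) (0≤rootSeq n x k) r≤B (<⇒≤ 0<η) (p⊓q≤q θ 1ℚ) ⟩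
        r ^ n + η * K                      ≤⟨ +-monoʳ-≤ (r ^ n) η*K≤½*ε ⟩
        r ^ n + ½ * ε                      ∎)))
      where
      r-bounded = bounded (rootʳ n x)
      B = proj₁ r-bounded
      L = proj₁ (proj₂ (proj₂ r-bounded))
      lipschitz = ^-lipschitz n (<⇒≤ (proj₁ (proj₂ r-bounded)))
      K = proj₁ lipschitz
      0<K = proj₁ (proj₂ lipschitz)
      -- Chosen so that `θ * K` is `½ * ε`; the cap at 1 in `η` meets the side condition of
      -- `^-lipschitz`.
      θ = ½ * ε * recip K 0<K
      η = θ ⊓ 1ℚ
      0<η : 0ℚ < η
      0<η = 0<p⊓q (0<p*q (0<½* 0<ε) (0<recip K 0<K)) 0<1
      N = proj₁ (narrow n x 0<η)
      k = M ℕ.⊔ (L ℕ.⊔ N)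
      r = rootSeq n x k
      r≤B : r ≤ B
      r≤B = ≤-trans (p≤∣p∣ r) (proj₂ (proj₂ (proj₂ r-bounded)) (ℕ.≤-trans (ℕ.m≤m⊔n L N) (ℕ.m≤n⊔m M (L ℕ.⊔ N))))
      η*K≤½*ε : η * K ≤ ½ * ε
      η*K≤½*ε = begin
        η * K                      ≤⟨ *-monoʳ-≤-nonNeg K {{nonNegative (<⇒≤ 0<K)}} (p⊓q≤p θ 1ℚ) ⟩
        θ * K                      ≡⟨ *-comm θ K ⟩
        K * (½ * ε * recip K 0<K)  ≡⟨ p*[q*recip] K (½ * ε) 0<K ⟩
        ½ * ε                      ∎

  -- Bounds on triads from the inconsistency index.

  seq-≤-max : ∀ {n} .{{_ : NonZero n}} (x : Vector ℝ n) i k → seq (x i) k ≤ seq (max x) k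
  seq-≤-max {suc zero}    x zero    k = ≤-refl
  seq-≤-max {suc (suc n)} x zero    k = p≤p⊔q (seq (x zero) k) (seq (max (x ∘ suc)) k)
  seq-≤-max {suc (suc n)} x (suc i) k = ≤-trans (seq-≤-max (x ∘ suc) i k) (p≤q⊔p (seq (x zero) k) (seq (max (x ∘ suc)) k))

  1-p≤q⇒1-q≤p : ∀ {p q} → 1ℚ - p ≤ q → 1ℚ - q ≤ p
  1-p≤q⇒1-q≤p {p} {q} h = begin
    1ℚ - q             ≡⟨ solve 2 (λ p q → con 1ℚ :- q := con 1ℚ :- p :+ (p :- q)) refl p q ⟩
    1ℚ - p + (p - q)   ≤⟨ +-monoˡ-≤ (p - q) h ⟩
    q + (p - q)        ≡⟨ solve 2 (λ p q → q :+ (p :- q) := p) refl p q ⟩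
    p                  ∎

  module _ {n} .{{_ : NonZero n}} (c : PCMatrix n) where

    -- Maxima and differences of reals are computed termwise, so bounding one term by the triple
    -- maximum and subtracting from 1 works at every index.
    1-KI-≤-triadRatio : ∀ i j k m → seq (value (1-KI c)) m ≤ seq (value (triadRatio c i j k)) m
    1-KI-≤-triadRatio i j k m = 1-p≤q⇒1-q≤p {seq (value (triadRatio c i j k)) m} (begin
      seq (term i j k) m                  ≤⟨ seq-≤-max (term i j) k m ⟩
      seq (max (term i j)) m              ≤⟨ seq-≤-max (λ j → max (term i j)) j m ⟩
      seq (max (λ j → max (term i j))) m  ≤⟨ seq-≤-max (λ i → max λ j → max (term i j)) i m ⟩
      seq (KI c) m                        ∎)
      where
      term : Fin n → Fin n → Fin n → ℝ
      term i j k = 1ʳ -ʳ value (triadRatio c i j k)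

    1-KI≼direct÷path : ∀ i j k → 1-KI c ≼ c i j ÷₊ (c i k · c k j)
    1-KI≼direct÷path i j k = eventually-≤⇒≯ (value (1-KI c)) (value direct÷path) (0 , λ {m} _ →
      ≤-trans (1-KI-≤-triadRatio i j k m) (p⊓q≤p (seq (value direct÷path) m) (seq (value path÷direct) m)))
      where
      direct÷path = c i j ÷₊ (c i k · c k j)
      path÷direct = (c i k · c k j) ÷₊ c i j

    1-KI≼path÷direct : ∀ i j k → 1-KI c ≼ (c i k · c k j) ÷₊ c i j
    1-KI≼path÷direct i j k = eventually-≤⇒≯ (value (1-KI c)) (value path÷direct) (0 , λ {m} _ →
      ≤-trans (1-KI-≤-triadRatio i j k m) (p⊓q≤q (seq (value direct÷path) m) (seq (value path÷direct) m)))
      where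
      direct÷path = c i j ÷₊ (c i k · c k j)
      path÷direct = (c i k · c k j) ÷₊ c i j

-- Order preservation for the priority vector.

open import Data.Nat using (_<_)

theorem3 : ∀ (n : ℕ) .{{_ : NonZero n}} → 2 < n →
    (c : PCMatrix n) → Reciprocal c → (i j k l : Fin n) →
    c i j >₊ 1₊ ÷₊ 1-KI c →
    c k l >₊ 1₊ ÷₊ 1-KI c →
    c i j ÷₊ c k l >₊ (1₊ ÷₊ 1-KI c) · (1₊ ÷₊ 1-KI c) →
    (priority c i >₊ priority c j) × (priority c k >₊ priority c l) ×
    (priority c i ÷₊ priority c j >₊ priority c k ÷₊ priority c l)
-- The group operations unfold to `_·_` and `_÷₊_`, and `priority` to a constant times
-- `geometricMean`, so the abstract result has the required type by computation.
theorem3 n _ c reciprocal = GeometricMean.g-order-preservation orderedAbelianGroup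
  c reciprocal≋ (1-KI c) (1-KI≼direct÷path c) (1-KI≼path÷direct c)
  (geometricMean c) (λ i → √-⋆ n (∏ (c i))) (∏ λ s → geometricMean c s ⁻¹)
  where
  open PositiveReals
  open OrderedAbelianGroup orderedAbelianGroup using (_≋_)
  reciprocal≋ : ∀ i j → c i j · c j i ≋ 1₊
  reciprocal≋ i j =
    ≈⇒≯ (value (c i j · c j i)) 1ʳ (reciprocal i j) ,
    ≈⇒≯ 1ʳ (value (c i j · c j i)) (≈-sym (value (c i j · c j i)) 1ʳ (reciprocal i j))
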